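{- Let $\Gamma$ be a flat green Veldkamp quadrangle with point set $P$ and line set $L$, and let $L_1=\{\Gamma_x\mid x\in L\}$. Then: (i) $S_\Gamma:=(P,L_1)$ is a thick non-degenerate polar space with $L_1\neq\emptyset$; (ii) the constructions $\Gamma\mapsto S_\Gamma$ and $S\mapsto\Gamma_S$ are mutually inverse (i.e. $\Gamma_{S_\Gamma}$ is isomorphic to $\Gamma$, including local opposition relations, via $a\mapsto a$, $x\mapsto\Gamma_x$, and $S_{\Gamma_S}=S$ for every thick non-degenerate polar space $S$ with at least one line); (iii) ${\rm rk}(S_\Gamma)=2$ if and only if $\Gamma$ is a generalized quadrangle.
   Context: A line space is a pair $S=(P,L)$ with $L$ a set of subsets (lines) of the point set $P$, each of size at least $2$; thick if every line has at least $3$ points. Collinear points lie on a common line; $a^\perp$ is the set of points collinear with $a$ (including $a$). A subspace is a set $X\subseteq P$ such that each line is contained in $X$ or meets it in at most one point; $\langle X\rangle$ is the smallest subspace containing $X$; a subspace is singular if any two of its points are collinear. A polar space is a line space such that for all $a\in P$, $x\in L$, either $|a^\perp\cap x|=1$ or $x\subseteq a^\perp$; non-degenerate if $a^\perp\ne P$ for all $a$. In a non-degenerate polar space singular subspaces are projective spaces; ${\rm rk}(S)$ is one more than the supremum of their projective dimensions. For such $S$ with $L\ne\emptyset$, $\Gamma_S$ is the incidence graph (vertices $P\cup L$, edges $\{a,x\}$ with $a\in x$) with local opposition: lines $x,y$ through a point $a$ are opposite at $a$ iff $\langle x\cup y\rangle$ is not singular; points on a line are opposite at that line iff distinct. Graph/Veldkamp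 notions: $\Gamma_v$ is the set of neighbors of $v$; an $s$-path is a sequence of vertices with consecutive ones adjacent and $x_{i-2}\ne x_i$; a closed $s$-path ($s\ge3$) has equal first and last vertex and determines an $s$-circuit. An opposition relation is a symmetric anti-reflexive relation; trivial if all distinct elements are related; $k$-plump if any $\le k$ elements have a common opposite. A Veldkamp graph is a graph with a $2$-plump opposition relation $\equiv_v$ on each $\Gamma_v$; a path $(v_0,\dots,v_s)$ is straight if $v_{i-1}\equiv_{v_i}v_{i+1}$ for $i\in[1,s-1]$; a circuit is straight if all its paths are. A Veldkamp $n$-gon satisfies (VP1) connected, bipartite; (VP2) for $k\in[1,n-1]$ each straight $k$-path is the unique straight path of length $\le k$ between its endpoints; (VP3) every straight $(n+1)$-path lies in a straight $2n$-circuit. A root is a straight $n$-path; vertices are opposite if joined by a root; $x^{\rm op}$ is the set of vertices opposite $x$; flat means $x^{\rm op}=y^{\rm op}\Rightarrow x=y$. A Veldkamp quadrangle is a Veldkamp $4$-gon with bipartition classes points $P$ and lines $L$; green means the relations at lines are trivial. A generalized quadrangle is a bipartite graph of diameter $4$ with no circuits of length less than $8$ and all degrees at least $2$. -}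

module Defs where

open import Level using (Lift; lift) renaming (suc to lsuc)
open import Axiom.ExcludedMiddle using (ExcludedMiddle)
open import Data.Bool.Base using (Bool)
open import Data.Empty using (⊥)
open import Data.Fin.Base using (Fin)
open import Data.List.Base using (List; length)
open import Data.List.Relation.Unary.All using (All)
open import Data.Nat.Base using (ℕ; suc; _+_; _*_; _≤_; _<_)
open import Data.Product.Base using (∃-syntax; Σ; Σ-syntax; _×_; _,_)
open import Data.Sum.Base using (_⊎_; inj₁; inj₂)
open import Data.Sum.Relation.Binary.Pointwise using (_⊎ₛ_; inj₁; inj₂)
open import Function.Bundles using (_⇔_)
open import Function.Definitions using (Congruent; Injective; Surjective)
open import Relation.Binary.Bundles using (Setoid)
open import Relation.Binary.Core using (Rel)
open import Relation.Binary.Definitions using (Symmetric)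
open import Relation.Binary.PropositionalEquality.Core using (_≡_; _≢_)
open import Relation.Nullary using (¬_; yes; no)
open import Relation.Nullary.Construct.Add.Supremum using (_⁺; ⊤⁺; [_])
open import Relation.Nullary.Negation.Core using (contradiction)
open import Relation.Unary using (Pred; _⊆_; _∪_; _≐_)
import Relation.Binary.Construct.Add.Supremum.NonStrict as Supremum

-- The mathematics is set-based: every carrier is a setoid, whose equality is
-- the equality of the set it stands for.

-- `Opp v x y` is the relation at v, on the neighbours of v.  That it is an
-- opposition relation is not part of the data (see IsVeldkampGraph).
record OppGraph {ℓ} (V : Setoid ℓ ℓ) : Set (lsuc ℓ) where
  open Setoid V renaming (Carrier to Vertex)
  infix 4 _~_
  field
    _~_         : Rel Vertex ℓ
    ~-resp      : ∀ {u u′ v v′} → u ≈ u′ → v ≈ v′ → u ~ v → u′ ~ v′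
    ~-sym       : Symmetric _~_
    ~-irrefl    : ∀ {u v} → u ≈ v → ¬ (u ~ v)
    Opp         : Vertex → Rel Vertex ℓ
    Opp-resp    : ∀ {v v′ x x′ y y′} → v ≈ v′ → x ≈ x′ → y ≈ y′ →
                  Opp v x y → Opp v′ x′ y′
    Opp-support : ∀ {v x y} → Opp v x y → v ~ x × v ~ y

module _ {ℓ} {A : Set ℓ} (X : Pred A ℓ) (R : Rel A ℓ) where

  -- Sets with at most k elements are given by lists of length at most k.
  -- The empty list is allowed, so X is inhabited if R is k-plump on X.
  Plump : ℕ → Set ℓ
  Plump k = ∀ (xs : List A) → length xs ≤ k → All X xs →
            ∃[ y ] X y × All (λ x → R x y) xs

module _ {ℓ} {V : Setoid ℓ ℓ} (Γ : OppGraph V) where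
  open Setoid V renaming (Carrier to Vertex)
  open OppGraph Γ

  record IsVeldkampGraph : Set ℓ where
    field
      opp-sym        : ∀ v → Symmetric (Opp v)
      opp-antireflex : ∀ v {x y} → x ≈ y → ¬ Opp v x y
      opp-plump      : ∀ v → Plump (v ~_) (Opp v) 2

  -- An s-path (x₀,…,xₛ) is represented by a sequence of which only the
  -- terms with index ≤ s matter.
  IsPath : ℕ → (ℕ → Vertex) → Set ℓ
  IsPath s p = (∀ i → i < s → p i ~ p (suc i)) ×
               (∀ i → suc i < s → ¬ (p i ≈ p (suc (suc i))))

  IsStraight : ℕ → (ℕ → Vertex) → Set ℓ
  IsStraight s p = IsPath s p ×
                   (∀ i → suc i < s → Opp (p (suc i)) (p i) (p (suc (suc i))))

  Joined : ℕ → Vertex → Vertex → Set ℓ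
  Joined s u v = ∃[ p ] IsPath s p × p 0 ≈ u × p s ≈ v

  shift : ℕ → (ℕ → Vertex) → (ℕ → Vertex)
  shift j c i = c (j + i)

  -- A circuit is a closed path read cyclically, that is, an s-periodic
  -- sequence; its paths are its finite windows.
  IsCircuit : ℕ → (ℕ → Vertex) → Set ℓ
  IsCircuit s c = 3 ≤ s × (∀ i → c (s + i) ≈ c i) × (∀ j t → IsPath t (shift j c))

  IsStraightCircuit : ℕ → (ℕ → Vertex) → Set ℓ
  IsStraightCircuit s c = IsCircuit s c × (∀ j t → IsStraight t (shift j c))

  LiesIn : ℕ → (ℕ → Vertex) → (ℕ → Vertex) → Set ℓ
  LiesIn t p c = ∃[ j ] (∀ i → i ≤ t → p i ≈ shift j c i)

  Connected : Set ℓ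
  Connected = Vertex × (∀ u v → ∃[ s ] Joined s u v)

  Bipartite : Set ℓ
  Bipartite = Σ[ colour ∈ (Vertex → Bool) ]
              (∀ {u v} → u ≈ v → colour u ≡ colour v) ×
              (∀ {u v} → u ~ v → colour u ≢ colour v)

  record IsVeldkampPolygon (n : ℕ) : Set ℓ where
    field
      isVeldkampGraph : IsVeldkampGraph
      VP1 : Connected × Bipartite
      VP2 : ∀ k → 1 ≤ k → k < n → ∀ p → IsStraight k p →
            ∀ j → j ≤ k → ∀ q → IsStraight j q → q 0 ≈ p 0 → q j ≈ p k →
            j ≡ k × (∀ i → i ≤ k → q i ≈ p i)
      VP3 : ∀ p → IsStraight (suc n) p →
            ∃[ c ] IsStraightCircuit (2 * n) c × LiesIn (suc n) p c

  -- Opposition of vertices, as opposed to the local relations Opp.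
  Opposite : ℕ → Rel Vertex ℓ
  Opposite n u v = ∃[ p ] IsStraight n p × p 0 ≈ u × p n ≈ v

  IsFlat : ℕ → Set ℓ
  IsFlat n = ∀ x y → (∀ z → Opposite n x z ⇔ Opposite n y z) → x ≈ y

  HasDiameter : ℕ → Set ℓ
  HasDiameter d = (∀ u v → ∃[ s ] s ≤ d × Joined s u v) ×
                  (∃[ u ] ∃[ v ] (∀ s → Joined s u v → d ≤ s))

  record IsGeneralizedQuadrangle : Set ℓ where
    field
      bipartite : Bipartite
      diameter  : HasDiameter 4
      girth     : ∀ s c → IsCircuit s c → 8 ≤ s
      degrees   : ∀ v → ∃[ x ] ∃[ y ] v ~ x × v ~ y × ¬ (x ≈ y)

record IsIsomorphism {ℓ} {V W : Setoid ℓ ℓ} (Γ : OppGraph V) (Δ : OppGraph W)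
                     (f : Setoid.Carrier V → Setoid.Carrier W) : Set ℓ where
  private
    module V = Setoid V
    module W = Setoid W
    module Γ = OppGraph Γ
    module Δ = OppGraph Δ
  field
    cong       : Congruent V._≈_ W._≈_ f
    injective  : Injective V._≈_ W._≈_ f
    surjective : Surjective V._≈_ W._≈_ f
    adjacency  : ∀ u v → (u Γ.~ v) ⇔ (f u Δ.~ f v)
    opposition : ∀ v x y → Γ.Opp v x y ⇔ Δ.Opp (f v) (f x) (f y)

module _ {ℓ} {P L : Setoid ℓ ℓ} (Γ : OppGraph (P ⊎ₛ L)) where
  private
    module P = Setoid P
    module L = Setoid L
  open OppGraph Γ

  IsBipartition : Set ℓ
  IsBipartition = (∀ (a b : P.Carrier) → ¬ (inj₁ a ~ inj₁ b)) ×
                  (∀ (x y : L.Carrier) → ¬ (inj₂ x ~ inj₂ y))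

  IsGreen : Set ℓ
  IsGreen = ∀ (x : L.Carrier) {u v} → inj₂ x ~ u → inj₂ x ~ v →
            ¬ (Setoid._≈_ (P ⊎ₛ L) u v) → Opp (inj₂ x) u v

  record IsFlatGreenVeldkampQuadrangle : Set ℓ where
    field
      bipartition         : IsBipartition
      isVeldkampPolygon   : IsVeldkampPolygon Γ 4
      flat                : IsFlat Γ 4
      green               : IsGreen

-- A set of subsets of P, given as a family: `points x` is the member of the
-- set with index x.  Indices of extensionally equal subsets stand for the
-- same line (see _≈ˡ_).
record PointLineStructure {ℓ} (P : Setoid ℓ ℓ) : Set (lsuc ℓ) where
  open Setoid P renaming (Carrier to Point)
  field
    Line        : Set ℓ
    points      : Line → Pred Point ℓ
    points-resp : ∀ x {a b} → a ≈ b → points x a → points x b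

  infix 4 _≈ˡ_
  _≈ˡ_ : Rel Line ℓ
  x ≈ˡ y = points x ≐ points y

  lineSetoid : Setoid ℓ ℓ
  lineSetoid = record
    { Carrier = Line
    ; _≈_ = _≈ˡ_
    ; isEquivalence = record
      { refl  = (λ p → p) , (λ p → p)
      ; sym   = λ (f , g) → g , f
      ; trans = λ (f , g) (h , k) → (λ p → h (f p)) , (λ p → g (k p))
      }
    }

  IsLine : Pred (Pred Point ℓ) ℓ
  IsLine X = ∃[ x ] X ≐ points x

-- Equality of line spaces with the same point set: equality of the two sets
-- of subsets.
infix 4 _≋_
_≋_ : ∀ {ℓ} {P : Setoid ℓ ℓ} → Rel (PointLineStructure P) (lsuc ℓ)
_≋_ {ℓ} {P} S T = ∀ (X : Pred (Setoid.Carrier P) ℓ) →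
                  PointLineStructure.IsLine S X ⇔ PointLineStructure.IsLine T X

module _ {ℓ} {P : Setoid ℓ ℓ} (S : PointLineStructure P) where
  open Setoid P renaming (Carrier to Point)
  open PointLineStructure S

  IsLineSpace : Set ℓ
  IsLineSpace = ∀ x → ∃[ a ] ∃[ b ] points x a × points x b × ¬ (a ≈ b)

  IsThick : Set ℓ
  IsThick = ∀ x → ∃[ a ] ∃[ b ] ∃[ c ] points x a × points x b × points x c ×
                  ¬ (a ≈ b) × ¬ (b ≈ c) × ¬ (a ≈ c)

  -- `a ⟂ b` means b ∈ a^⊥; in particular a ⟂ a.
  infix 4 _⟂_
  _⟂_ : Rel Point ℓ
  a ⟂ b = a ≈ b ⊎ ∃[ x ] points x a × points x b

  record IsPolarSpace : Set ℓ where
    field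
      isLineSpace : IsLineSpace
      oneOrAll    : ∀ a x →
        (∃[ b ] points x b × a ⟂ b × (∀ c → points x c → a ⟂ c → c ≈ b)) ⊎
        (∀ b → points x b → a ⟂ b)

  IsNonDegenerate : Set ℓ
  IsNonDegenerate = ∀ a → ¬ (∀ b → a ⟂ b)

  record IsSubspace (X : Pred Point ℓ) : Set ℓ where
    field
      resp  : ∀ {a b} → a ≈ b → X a → X b
      lines : ∀ x → points x ⊆ X ⊎
                    (∀ {a b} → points x a → X a → points x b → X b → a ≈ b)

  IsSingular : Pred Point ℓ → Set ℓ
  IsSingular X = ∀ {a b} → X a → X b → a ⟂ b

  -- The smallest subspace containing X (see ⟨⟩-isSubspace, ⟨⟩-smallest).
  data ⟨_⟩ (X : Pred Point ℓ) : Pred Point ℓ where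
    incl : ∀ {a} → X a → ⟨ X ⟩ a
    resp : ∀ {a b} → a ≈ b → ⟨ X ⟩ a → ⟨ X ⟩ b
    join : ∀ {a b c} x → ⟨ X ⟩ a → ⟨ X ⟩ b → ¬ (a ≈ b) →
           points x a → points x b → points x c → ⟨ X ⟩ c

  ⟨⟩-smallest : ∀ {X Y} → IsSubspace Y → X ⊆ Y → ⟨ X ⟩ ⊆ Y
  ⟨⟩-smallest Y-sub X⊆Y (incl p)   = X⊆Y p
  ⟨⟩-smallest Y-sub X⊆Y (resp e p) =
    IsSubspace.resp Y-sub e (⟨⟩-smallest Y-sub X⊆Y p)
  ⟨⟩-smallest Y-sub X⊆Y (join x p q a≉b a∈x b∈x c∈x)
    with IsSubspace.lines Y-sub x
  ... | inj₁ x⊆Y = x⊆Y c∈x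
  ... | inj₂ ≤1  = contradiction
    (≤1 a∈x (⟨⟩-smallest Y-sub X⊆Y p) b∈x (⟨⟩-smallest Y-sub X⊆Y q)) a≉b

  ⟨⟩-isSubspace : ExcludedMiddle ℓ → ∀ X → IsSubspace ⟨ X ⟩
  ⟨⟩-isSubspace em X = record { resp = resp ; lines = lines }
    where
    Secant : Line → Set ℓ
    Secant x = ∃[ a ] ∃[ b ]
      points x a × ⟨ X ⟩ a × points x b × ⟨ X ⟩ b × ¬ (a ≈ b)

    lines : ∀ x → points x ⊆ ⟨ X ⟩ ⊎
            (∀ {a b} → points x a → ⟨ X ⟩ a → points x b → ⟨ X ⟩ b → a ≈ b)
    lines x with em {Secant x}
    ... | yes (a , b , a∈x , p , b∈x , q , a≉b) =
      inj₁ (λ c∈x → join x p q a≉b a∈x b∈x c∈x)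
    ... | no ¬secant = inj₂ one
      where
      one : ∀ {a b} → points x a → ⟨ X ⟩ a → points x b → ⟨ X ⟩ b → a ≈ b
      one {a} {b} a∈x p b∈x q with em {a ≈ b}
      ... | yes a≈b = a≈b
      ... | no a≉b  =
        contradiction (a , b , a∈x , p , b∈x , q , a≉b) ¬secant

  ⟨⟩-mono : ∀ {X Y : Pred Point ℓ} → X ⊆ Y → ⟨ X ⟩ ⊆ ⟨ Y ⟩
  ⟨⟩-mono f (incl p)                       = incl (f p)
  ⟨⟩-mono f (resp e p)                     = resp e (⟨⟩-mono f p)
  ⟨⟩-mono f (join x p q a≉b a∈x b∈x c∈x) =
    join x (⟨⟩-mono f p) (⟨⟩-mono f q) a≉b a∈x b∈x c∈x

  image : ∀ {k} → (Fin k → Point) → Pred Point ℓ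
  image v a = ∃[ i ] a ≈ v i

  Independent : ∀ {k} → (Fin k → Point) → Set ℓ
  Independent v = ∀ i → ¬ ⟨ (λ a → ∃[ j ] j ≢ i × a ≈ v j) ⟩ (v i)

  HasBasis : Pred Point ℓ → ℕ → Set ℓ
  HasBasis U k = Σ[ v ∈ (Fin k → Point) ] Independent v × ⟨ image v ⟩ ≐ U

  ℕ∞ : Set
  ℕ∞ = ℕ ⁺

  open Supremum _≤_ using (_≤⁺_)

  -- One more than the projective dimension of U.
  Dimension+1 : Pred Point ℓ → ℕ∞ → Set ℓ
  Dimension+1 U [ k ] = HasBasis U k
  Dimension+1 U ⊤⁺    = ∀ k → ¬ HasBasis U k

  IsRankBound : ℕ∞ → Set (lsuc ℓ)
  IsRankBound r = ∀ U → IsSubspace U → IsSingular U →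
                  ∀ d → Dimension+1 U d → d ≤⁺ r

  -- rk(S) = r.  One more than the supremum of the projective dimensions is
  -- the supremum of the dimensions increased by one.
  HasRank : ℕ∞ → Set (lsuc ℓ)
  HasRank r = IsRankBound r × (∀ s → IsRankBound s → r ≤⁺ s)

-- Γ_x for a line x of Γ, as a set of points.
Γ[_]_ : ∀ {ℓ} {P L : Setoid ℓ ℓ} → OppGraph (P ⊎ₛ L) →
        Setoid.Carrier L → Pred (Setoid.Carrier P) ℓ
(Γ[ Γ ] x) a = OppGraph._~_ Γ (inj₂ x) (inj₁ a)

-- S_Γ = (P , {Γ_x ∣ x ∈ L})
lineSpace : ∀ {ℓ} {P L : Setoid ℓ ℓ} → OppGraph (P ⊎ₛ L) → PointLineStructure P
lineSpace {P = P} {L} Γ = record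
  { Line        = Setoid.Carrier L
  ; points      = Γ[ Γ ]_
  ; points-resp = λ x a≈b → OppGraph.~-resp Γ (inj₂ (Setoid.refl L)) (inj₁ a≈b)
  }

-- Γ_S
incidenceGraph : ∀ {ℓ} {P : Setoid ℓ ℓ} (S : PointLineStructure P) →
                 OppGraph (P ⊎ₛ PointLineStructure.lineSetoid S)
incidenceGraph {ℓ} {P} S = record
  { _~_         = Adj
  ; ~-resp      = resp~
  ; ~-sym       = λ {u} {v} → sym~ {u} {v}
  ; ~-irrefl    = irrefl~
  ; Opp         = Opposed
  ; Opp-resp    = respOpp
  ; Opp-support = λ {v} {x} {y} → support {v} {x} {y}
  }
  where
  open Setoid P renaming (Carrier to Point)
  open PointLineStructure S
  open Setoid (P ⊎ₛ lineSetoid) using () renaming (Carrier to Vertex; _≈_ to _≈ᵛ_)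

  Adj : Rel Vertex ℓ
  Adj (inj₁ a) (inj₂ x) = points x a
  Adj (inj₂ x) (inj₁ a) = points x a
  Adj (inj₁ a) (inj₁ b) = Lift ℓ ⊥
  Adj (inj₂ x) (inj₂ y) = Lift ℓ ⊥

  Opposed : Vertex → Rel Vertex ℓ
  Opposed (inj₁ a) (inj₂ x) (inj₂ y) =
    points x a × points y a × ¬ IsSingular S (⟨_⟩ S (points x ∪ points y))
  Opposed (inj₂ x) (inj₁ a) (inj₁ b) = points x a × points x b × ¬ (a ≈ b)
  Opposed _        _        _        = Lift ℓ ⊥

  resp~ : ∀ {u u′ v v′} → u ≈ᵛ u′ → v ≈ᵛ v′ → Adj u v → Adj u′ v′
  resp~ (inj₁ e) (inj₂ {x} {y} (f , g)) p = points-resp y e (f p)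
  resp~ (inj₂ {x} {y} (f , g)) (inj₁ e) p = points-resp y e (f p)
  resp~ (inj₁ _) (inj₁ _) (lift ())
  resp~ (inj₂ _) (inj₂ _) (lift ())

  sym~ : Symmetric Adj
  sym~ {inj₁ a} {inj₂ x} p = p
  sym~ {inj₂ x} {inj₁ a} p = p
  sym~ {inj₁ _} {inj₁ _} (lift ())
  sym~ {inj₂ _} {inj₂ _} (lift ())

  irrefl~ : ∀ {u v} → u ≈ᵛ v → ¬ Adj u v
  irrefl~ (inj₁ _) (lift ())
  irrefl~ (inj₂ _) (lift ())

  ∪-mono : ∀ {x x′ y y′} → points x′ ⊆ points x → points y′ ⊆ points y →
           (points x′ ∪ points y′) ⊆ (points x ∪ points y)
  ∪-mono f g (inj₁ p) = inj₁ (f p)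
  ∪-mono f g (inj₂ p) = inj₂ (g p)

  respOpp : ∀ {v v′ x x′ y y′} → v ≈ᵛ v′ → x ≈ᵛ x′ → y ≈ᵛ y′ →
            Opposed v x y → Opposed v′ x′ y′
  respOpp (inj₁ e) (inj₂ {x} {x′} (f , f⁻)) (inj₂ {y} {y′} (g , g⁻)) (p , q , ns) =
    points-resp x′ e (f p) , points-resp y′ e (g q) ,
    λ s → ns (λ m n → s (⟨⟩-mono S (∪-mono {x′} {x} {y′} {y} f g) m)
                        (⟨⟩-mono S (∪-mono {x′} {x} {y′} {y} f g) n))
  respOpp (inj₂ {x} {x′} (f , _)) (inj₁ e) (inj₁ e′) (p , q , a≉b) =
    points-resp x′ e (f p) , points-resp x′ e′ (f q) ,
    λ e″ → a≉b (trans e (trans e″ (sym e′)))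
  respOpp (inj₁ _) (inj₁ _) _        (lift ())
  respOpp (inj₁ _) (inj₂ _) (inj₁ _) (lift ())
  respOpp (inj₂ _) (inj₂ _) _        (lift ())
  respOpp (inj₂ _) (inj₁ _) (inj₂ _) (lift ())

  support : ∀ {v x y} → Opposed v x y → Adj v x × Adj v y
  support {inj₁ a} {inj₂ x} {inj₂ y} (p , q , _) = p , q
  support {inj₂ x} {inj₁ a} {inj₁ b} (p , q , _) = p , q
  support {inj₁ _} {inj₁ _} (lift ())
  support {inj₁ _} {inj₂ _} {inj₁ _} (lift ())
  support {inj₂ _} {inj₂ _} (lift ())
  support {inj₂ _} {inj₁ _} {inj₂ _} (lift ())

-- The map a ↦ a, x ↦ Γ_x from Γ to Γ_{S_Γ}: the index of the line Γ_x of S_Γ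
-- is x.
canonicalMap : ∀ {ℓ} {P L : Setoid ℓ ℓ} (Γ : OppGraph (P ⊎ₛ L)) →
               Setoid.Carrier (P ⊎ₛ L) →
               Setoid.Carrier (P ⊎ₛ PointLineStructure.lineSetoid (lineSpace Γ))
canonicalMap Γ (inj₁ a) = inj₁ a
canonicalMap Γ (inj₂ x) = inj₂ x

{-# OPTIONS --safe #-}
module Submission where

-- A circuit completing a straight 5-path (VP3) and 2-plumpness show that a
-- point opposite to some point of a line w projects to a unique point of w,
-- and that opposite points are not collinear. Call two points near if they
-- are neither collinear nor opposite: near points with a common neighbour
-- have the same opposite points, so by flatness there are none. Hence the
-- points on two lines through c which are not opposite at c are pairwise
-- collinear, and the axiom of a polar space spreads along the paths from a
-- given point by connectedness. The rank is 2 iff there is no triangle, which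
-- is the same as the absence of short circuits.

open import Defs
open import Level using (Lift; lift; lower) renaming (suc to lsuc)
open import Axiom.ExcludedMiddle using (ExcludedMiddle)
open import Data.Bool.Base using (Bool; true; false; not)
open import Data.Empty using (⊥; ⊥-elim)
open import Data.Fin.Base using (Fin; zero; suc)
open import Data.List.Base using ([]; _∷_)
open import Data.List.Relation.Unary.All using ([]; _∷_)
open import Data.Nat.GeneralisedArithmetic using (fold)
open import Data.Nat.Base using (ℕ; zero; suc; _+_; _≤_; _<_; z≤n; s≤s)
open import Data.Nat.Properties using (+-comm; +-suc; +-identityʳ; ≤-refl; <⇒≤; m<n⇒m<1+n)
open import Data.Product.Base using (Σ-syntax; ∃-syntax; _×_; _,_; proj₁; proj₂)
open import Data.Sum.Base using (_⊎_; inj₁; inj₂; [_,_]′)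
open import Data.Sum.Relation.Binary.Pointwise using (_⊎ₛ_; inj₁; inj₂; drop-inj₁; drop-inj₂)
open import Data.Vec.Base using ([]; _∷_; lookup)
open import Function.Base using (const; id; _∘_)
open import Function.Bundles using (_⇔_; mk⇔)
open import Relation.Binary.Bundles using (Setoid)
open import Relation.Binary.PropositionalEquality.Core using (_≡_; _≢_; refl; cong; subst)
  renaming (sym to ≡-sym; trans to ≡-trans)
open import Relation.Nullary.Decidable using (map′)
open import Relation.Nullary using (¬_; yes; no; contradiction)
import Relation.Binary.Construct.Add.Supremum.NonStrict as Supremum
open import Relation.Nullary.Construct.Add.Supremum using (⊤⁺; [_])
open import Relation.Unary using (_⊆_; _∪_; _≐_)

-- Paths as sequences.

cons : ∀ {a} {A : Set a} → A → (ℕ → A) → ℕ → A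
cons u p zero    = u
cons u p (suc i) = p i

module _ {ℓ} {V : Setoid ℓ ℓ} (Γ : OppGraph V) where
  open Setoid V renaming (Carrier to Vertex)
  open OppGraph Γ

  path-edge : ∀ {u p} → u ~ p 0 → IsPath Γ 1 (cons u p)
  path-edge e = (λ { zero _ → e ; (suc _) (s≤s ()) }) , (λ { _ (s≤s ()) })

  path-cons : ∀ {u p s} → u ~ p 0 → ¬ (u ≈ p 1) → IsPath Γ (suc s) p →
              IsPath Γ (suc (suc s)) (cons u p)
  path-cons e t (edge , turn) =
    (λ { zero _ → e ; (suc i) (s≤s q) → edge i q }) ,
    (λ { zero _ → t ; (suc i) (s≤s q) → turn i q })

  walk⇒paths : ∀ {c} → (∀ i → c i ~ c (suc i)) → (∀ i → ¬ (c i ≈ c (suc (suc i)))) →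
               ∀ j t → IsPath Γ t (shift Γ j c)
  walk⇒paths {c} edge turn j t =
    (λ i _ → subst (λ n → c (j + i) ~ c n) (≡-sym (+-suc j i)) (edge (j + i))) ,
    (λ i _ → subst (λ n → ¬ (c (j + i) ≈ c n))
                   (≡-sym (≡-trans (+-suc j (suc i)) (cong suc (+-suc j i)))) (turn (j + i)))

  straight-edge : ∀ {u p} → u ~ p 0 → IsStraight Γ 1 (cons u p)
  straight-edge e = path-edge e , (λ { _ (s≤s ()) })

  straight-cons : IsVeldkampGraph Γ → ∀ {u p s} → Opp (p 0) u (p 1) →
                  IsStraight Γ (suc s) p → IsStraight Γ (suc (suc s)) (cons u p)
  straight-cons veldkamp {p = p} o (path , opp) =
    path-cons (~-sym (proj₁ (Opp-support o)))
              (λ e → IsVeldkampGraph.opp-antireflex veldkamp (p 0) e o) path ,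
    (λ { zero _ → o ; (suc i) (s≤s q) → opp i q })

-- Collinearity and spans in a polar space.

module _ {ℓ} {P : Setoid ℓ ℓ} (S : PointLineStructure P) where
  open Setoid P renaming (Carrier to Point; sym to ≈-sym; trans to ≈-trans)
  open PointLineStructure S

  ⟂-sym : ∀ {a b} → _⟂_ S a b → _⟂_ S b a
  ⟂-sym (inj₁ e)           = inj₁ (≈-sym e)
  ⟂-sym (inj₂ (x , p , q)) = inj₂ (x , q , p)

  ⟂-respʳ : ∀ {a b c} → b ≈ c → _⟂_ S a b → _⟂_ S a c
  ⟂-respʳ e (inj₁ e′)          = inj₁ (≈-trans e′ e)
  ⟂-respʳ e (inj₂ (x , p , q)) = inj₂ (x , p , points-resp x e q)

  ⟂-joined : ∀ {a b} → ¬ (a ≈ b) → _⟂_ S a b → ∃[ x ] points x a × points x b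
  ⟂-joined a≉b (inj₁ e) = contradiction e a≉b
  ⟂-joined _   (inj₂ j) = j

  module _ (polar : IsPolarSpace S) where
    open IsPolarSpace polar

    -- The set a^⊥ is a subspace: by `oneOrAll`, a line with two distinct points in it lies in it
    -- entirely.
    ⟂-⟨⟩ : ∀ {X a} → (∀ {b} → X b → _⟂_ S a b) → ∀ {b} → ⟨_⟩ S X b → _⟂_ S a b
    ⟂-⟨⟩ f (incl p)   = f p
    ⟂-⟨⟩ f (resp e p) = ⟂-respʳ e (⟂-⟨⟩ f p)
    ⟂-⟨⟩ {a = a} f (join x p q b≉c b∈x c∈x d∈x) with oneOrAll a x
    ... | inj₂ all                  = all _ d∈x
    ... | inj₁ (_ , _ , _ , unique) = contradiction
      (≈-trans (unique _ b∈x (⟂-⟨⟩ f p)) (≈-sym (unique _ c∈x (⟂-⟨⟩ f q)))) b≉c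

    -- Two applications of `⟂-⟨⟩`: first a point of `X`, and then any point of its span, is
    -- collinear with the whole span.
    ⟨⟩-singular : ∀ {X} → IsSingular S X → IsSingular S (⟨_⟩ S X)
    ⟨⟩-singular sing p q =
      ⟂-⟨⟩ (λ b → ⟂-sym (⟂-⟨⟩ (λ c → sing b c) p)) q

-- Singular subspaces and rank 2.

module Rank {ℓ} (em : ExcludedMiddle ℓ) {P : Setoid ℓ ℓ} (S : PointLineStructure P)
            (polar : IsPolarSpace S) where
  open Setoid P renaming (Carrier to Point; refl to ≈-refl; sym to ≈-sym; trans to ≈-trans)
  open PointLineStructure S
  open Supremum _≤_ using (_≤⁺_; [_])

  -- The notion shared by rank and girth: a triangle spans a singular subspace larger than a line,
  -- and its points and sides form a 6-circuit.
  record Triangle : Set ℓ where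
    constructor triangle
    field
      {base}    : Line
      {a b c}   : Point
      a≉b       : ¬ (a ≈ b)
      a∈base    : points base a
      b∈base    : points base b
      c∉base    : ¬ points base c
      c⟂a       : _⟂_ S c a
      c⟂b       : _⟂_ S c b

  -- By `⟨⟩-smallest` the span of the other members stays inside `X`, so it misses `v i`.
  independent : ∀ {k} (v : Fin k → Point) →
    (∀ i → ∃[ X ] IsSubspace S X × ¬ X (v i) × (∀ j → j ≢ i → X (v j))) → Independent S v
  independent v avoid i vi∈ with avoid i
  ... | X , sub , vi∉X , others = vi∉X (⟨⟩-smallest S sub
    (λ (j , j≢i , e) → IsSubspace.resp sub (≈-sym e) (others j j≢i)) vi∈)

  ∅-isSubspace : IsSubspace S (λ _ → Lift ℓ ⊥)
  ∅-isSubspace = record { resp = λ _ p → p ; lines = λ _ → inj₂ (λ { _ (lift ()) }) }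

  point-isSubspace : ∀ a → IsSubspace S (_≈ a)
  point-isSubspace a = record
    { resp  = λ b≈c b≈a → ≈-trans (≈-sym b≈c) b≈a
    ; lines = λ _ → inj₂ (λ _ b≈a _ c≈a → ≈-trans b≈a (≈-sym c≈a))
    }

  module _ (unique : ∀ {a b x y} → ¬ (a ≈ b) → points x a → points x b →
                     points y a → points y b → points x ⊆ points y) where

    line-isSubspace : ∀ x → IsSubspace S (points x)
    line-isSubspace x = record { resp = points-resp x ; lines = lines }
      where
      lines : ∀ y → points y ⊆ points x ⊎
              (∀ {a b} → points y a → points x a → points y b → points x b → a ≈ b)
      lines y with em {∃[ a ] ∃[ b ] ¬ (a ≈ b) × points y a × points y b × points x a × points x b}
      ... | yes (_ , _ , a≉b , a∈y , b∈y , a∈x , b∈x) = inj₁ (unique a≉b a∈y b∈y a∈x b∈x)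
      ... | no none = inj₂ one
        where
        one : ∀ {a b} → points y a → points x a → points y b → points x b → a ≈ b
        one {a} {b} a∈y a∈x b∈y b∈x with em {a ≈ b}
        ... | yes a≈b = a≈b
        ... | no  a≉b = contradiction (_ , _ , a≉b , a∈y , b∈y , a∈x , b∈x) none

    line-basis : ∀ {U x a b} → U ≐ points x → ¬ (a ≈ b) → points x a → points x b → HasBasis S U 2
    line-basis {x = x} {a} {b} (U⊆x , x⊆U) a≉b a∈x b∈x =
      v , independent v avoid ,
      (λ p → x⊆U (⟨⟩-smallest S (line-isSubspace x) v⊆x p)) ,
      (λ p → join x (incl (zero , ≈-refl)) (incl (suc zero , ≈-refl)) a≉b a∈x b∈x (U⊆x p))
      where
      v : Fin 2 → Point
      v = lookup (a ∷ b ∷ [])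
      v⊆x : image S v ⊆ points x
      v⊆x (zero , e)     = points-resp x (≈-sym e) a∈x
      v⊆x (suc zero , e) = points-resp x (≈-sym e) b∈x
      avoid : ∀ i → ∃[ X ] IsSubspace S X × ¬ X (v i) × (∀ j → j ≢ i → X (v j))
      avoid zero = _ , point-isSubspace b , a≉b ,
        λ { zero ne → contradiction refl ne ; (suc zero) _ → ≈-refl }
      avoid (suc zero) = _ , point-isSubspace a , a≉b ∘ ≈-sym ,
        λ { zero _ → ≈-refl ; (suc zero) ne → contradiction refl ne }

    -- By `⟨⟩-singular` the span of the three vertices is singular. They form a basis of it, because
    -- each vertex avoids the line through the other two; this gives 3 ≤ 2.
    rank2⇒¬triangle : HasRank S [ 2 ] → ¬ Triangle
    rank2⇒¬triangle (bound , _) (triangle {x} {a} {b} {c} a≉b a∈x b∈x c∉x c⟂a c⟂b)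
      with ⟂-joined S (λ c≈a → c∉x (points-resp x (≈-sym c≈a) a∈x)) c⟂a
         | ⟂-joined S (λ c≈b → c∉x (points-resp x (≈-sym c≈b) b∈x)) c⟂b
    ... | z , c∈z , a∈z | y , c∈y , b∈y
      with bound (⟨_⟩ S (image S v)) (⟨⟩-isSubspace S em _) (⟨⟩-singular S polar singular)
                 [ 3 ] (v , independent v avoid , id , id)
      where
      v : Fin 3 → Point
      v = lookup (a ∷ b ∷ c ∷ [])
      a⟂b : _⟂_ S a b
      a⟂b = inj₂ (x , a∈x , b∈x)
      pairs : ∀ i j → _⟂_ S (v i) (v j)
      pairs zero             zero             = inj₁ ≈-refl
      pairs zero             (suc zero)       = a⟂b
      pairs zero             (suc (suc zero)) = ⟂-sym S c⟂a
      pairs (suc zero)       zero             = ⟂-sym S a⟂b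
      pairs (suc zero)       (suc zero)       = inj₁ ≈-refl
      pairs (suc zero)       (suc (suc zero)) = ⟂-sym S c⟂b
      pairs (suc (suc zero)) zero             = c⟂a
      pairs (suc (suc zero)) (suc zero)       = c⟂b
      pairs (suc (suc zero)) (suc (suc zero)) = inj₁ ≈-refl
      singular : IsSingular S (image S v)
      singular (i , e) (j , e′) =
        ⟂-sym S (⟂-respʳ S (≈-sym e) (⟂-sym S (⟂-respʳ S (≈-sym e′) (pairs i j))))
      avoid : ∀ i → ∃[ X ] IsSubspace S X × ¬ X (v i) × (∀ j → j ≢ i → X (v j))
      avoid zero = _ , line-isSubspace y , (λ a∈y → c∉x (unique a≉b a∈y b∈y a∈x b∈x c∈y)) ,
        λ { zero ne → contradiction refl ne ; (suc zero) _ → b∈y ; (suc (suc zero)) _ → c∈y }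
      avoid (suc zero) = _ , line-isSubspace z , (λ b∈z → c∉x (unique a≉b a∈z b∈z a∈x b∈x c∈z)) ,
        λ { zero _ → a∈z ; (suc zero) ne → contradiction refl ne ; (suc (suc zero)) _ → c∈z }
      avoid (suc (suc zero)) = _ , line-isSubspace x , c∉x ,
        λ { zero _ → a∈x ; (suc zero) _ → b∈x ; (suc (suc zero)) ne → contradiction refl ne }
    ... | [ s≤s (s≤s ()) ]

    -- Without triangles a singular subspace with two distinct points is the line joining them, so
    -- every singular subspace has a basis of size 0, 1 or 2. The line `l` shows that the bound 2 is
    -- attained.
    ¬triangle⇒rank2 : Line → ¬ Triangle → HasRank S [ 2 ]
    ¬triangle⇒rank2 l ¬triangle = bound , minimal
      where
      minimal : ∀ s → IsRankBound S s → [ 2 ] ≤⁺ s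
      minimal s s-bound with IsPolarSpace.isLineSpace polar l
      ... | a , b , a∈l , b∈l , a≉b =
        s-bound (points l) (line-isSubspace l) (λ p q → inj₂ (l , p , q)) [ 2 ]
                (line-basis {x = l} (id , id) a≉b a∈l b∈l)

      singular⊆line : ∀ {U a b x} → IsSingular S U → U a → U b → ¬ (a ≈ b) →
                      points x a → points x b → U ⊆ points x
      singular⊆line {x = x} sing a∈U b∈U a≉b a∈x b∈x {c} c∈U with em {points x c}
      ... | yes c∈x = c∈x
      ... | no  c∉x =
        contradiction (triangle a≉b a∈x b∈x c∉x (sing c∈U a∈U) (sing c∈U b∈U)) ¬triangle

      bound : IsRankBound S [ 2 ]
      bound U sub sing [ 0 ] _ = [ z≤n ]
      bound U sub sing [ 1 ] _ = [ s≤s z≤n ]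
      bound U sub sing [ 2 ] _ = [ ≤-refl ]
      bound U sub sing [ suc (suc (suc k)) ] (v , indep , ⟨v⟩⊆U , _) =
        ⊥-elim (indep (suc (suc zero)) (join x (incl (zero , (λ ()) , ≈-refl))
          (incl (suc zero , (λ ()) , ≈-refl)) v₀≉v₁ v₀∈x v₁∈x
          (singular⊆line sing (v∈U zero) (v∈U (suc zero)) v₀≉v₁ v₀∈x v₁∈x (v∈U (suc (suc zero))))))
        where
        v∈U : ∀ i → U (v i)
        v∈U i = ⟨v⟩⊆U (incl (i , ≈-refl))
        v₀≉v₁ : ¬ (v zero ≈ v (suc zero))
        v₀≉v₁ e = indep zero (incl (suc zero , (λ ()) , e))
        line = ⟂-joined S v₀≉v₁ (sing (v∈U zero) (v∈U (suc zero)))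
        x = proj₁ line
        v₀∈x = proj₁ (proj₂ line)
        v₁∈x = proj₂ (proj₂ line)
      -- Dimension `⊤⁺` says that no finite basis exists. It is refuted by a basis of size 0, 2 or 1
      -- when `U` is empty, has two distinct points, or is a single point.
      bound U sub sing ⊤⁺ noBasis with em {∃[ a ] U a}
      ... | no empty = ⊥-elim (noBasis 0 (lookup [] , (λ ()) ,
        (λ p → ⟨⟩-smallest S sub (λ { (() , _) }) p) , (λ a∈U → contradiction (_ , a∈U) empty)))
      ... | yes (a , a∈U) with em {∃[ b ] U b × ¬ (a ≈ b)}
      ... | yes (b , b∈U , a≉b) with ⟂-joined S a≉b (sing a∈U b∈U)
      ... | x , a∈x , b∈x =
        ⊥-elim (noBasis 2 (line-basis (singular⊆line sing a∈U b∈U a≉b a∈x b∈x , x⊆U) a≉b a∈x b∈x))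
        where
        x⊆U : points x ⊆ U
        x⊆U p with IsSubspace.lines sub x
        ... | inj₁ x⊆U = x⊆U p
        ... | inj₂ ≤1  = contradiction (≤1 a∈x a∈U b∈x b∈U) a≉b
      bound U sub sing ⊤⁺ noBasis | yes (a , a∈U) | no alone =
        ⊥-elim (noBasis 1 (v , independent v (λ { zero → _ , ∅-isSubspace , lower ,
                                                 λ { zero ne → contradiction refl ne } }) ,
          (λ p → ⟨⟩-smallest S sub (λ { (zero , e) → IsSubspace.resp sub (≈-sym e) a∈U }) p) ,
          (λ b∈U → incl (zero , only b∈U))))
        where
        v : Fin 1 → Point
        v = lookup (a ∷ [])
        only : ∀ {b} → U b → b ≈ a
        only {b} b∈U with em {a ≈ b}
        ... | yes a≈b = ≈-sym a≈b
        ... | no  a≉b = contradiction (b , b∈U , a≉b) alone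

-- The quadrangle: consequences of 2-plumpness.

module Quadrangle {ℓ} (em : ExcludedMiddle ℓ) {P L : Setoid ℓ ℓ}
                  (Γ : OppGraph (P ⊎ₛ L))
                  (isQuadrangle : IsFlatGreenVeldkampQuadrangle Γ) where
  open Setoid P renaming (Carrier to Point; refl to ≈-refl; sym to ≈-sym; trans to ≈-trans)
  open Setoid L using () renaming
    (Carrier to Line; _≈_ to _≈ˡ_; refl to ≈ˡ-refl; sym to ≈ˡ-sym)
  open Setoid (P ⊎ₛ L) using () renaming
    (Carrier to Vertex; _≈_ to _≈ᵛ_; refl to ≈ᵛ-refl; sym to ≈ᵛ-sym; trans to ≈ᵛ-trans)
  open OppGraph Γ
  open IsFlatGreenVeldkampQuadrangle isQuadrangle
  open IsVeldkampPolygon isVeldkampPolygon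
  open IsVeldkampGraph isVeldkampGraph

  S : PointLineStructure P
  S = lineSpace Γ

  infix 4 _∈_ _⟂ₛ_ _⟂̸_
  _∈_ : Point → Line → Set ℓ
  a ∈ x = inj₂ x ~ inj₁ a

  _⟂ₛ_ : Point → Point → Set ℓ
  _⟂ₛ_ = _⟂_ S

  OppAt : Point → Line → Line → Set ℓ
  OppAt a x y = Opp (inj₁ a) (inj₂ x) (inj₂ y)

  ∈-resp : ∀ {x a b} → a ≈ b → a ∈ x → b ∈ x
  ∈-resp e = ~-resp ≈ᵛ-refl (inj₁ e)

  ∈-respˡ : ∀ {x y a} → x ≈ˡ y → a ∈ x → a ∈ y
  ∈-respˡ e = ~-resp (inj₂ e) ≈ᵛ-refl

  OppAt⇒∈₁ : ∀ {a x y} → OppAt a x y → a ∈ x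
  OppAt⇒∈₁ o = ~-sym (proj₁ (Opp-support o))

  OppAt⇒∈₂ : ∀ {a x y} → OppAt a x y → a ∈ y
  OppAt⇒∈₂ o = ~-sym (proj₂ (Opp-support o))

  distinct : ∀ {x a b} → a ∈ x → b ∈ x → ¬ (a ≈ b) → Opp (inj₂ x) (inj₁ a) (inj₁ b)
  distinct {x} a∈x b∈x a≉b = green x a∈x b∈x (λ e → a≉b (drop-inj₁ e))

  -- Abstract because `with` would otherwise unfold these proofs at a prohibitive cost.
  abstract
    commonOpposite : ∀ {a} x y → a ∈ x → a ∈ y → ∃[ w ] OppAt a x w × OppAt a y w
    commonOpposite {a} x y a∈x a∈y
      with opp-plump (inj₁ a) (inj₂ x ∷ inj₂ y ∷ []) (s≤s (s≤s z≤n))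
                     (~-sym a∈x ∷ ~-sym a∈y ∷ [])
    ... | inj₁ b , a~b , _            = contradiction a~b (proj₁ bipartition a b)
    ... | inj₂ w , _ , (o ∷ o′ ∷ []) = w , o , o′

  lineThrough : ∀ a → ∃[ x ] a ∈ x
  lineThrough a with opp-plump (inj₁ a) [] z≤n []
  ... | inj₁ b , a~b , _ = contradiction a~b (proj₁ bipartition a b)
  ... | inj₂ x , a~x , _ = x , ~-sym a~x

  abstract
    -- This is 2-plumpness at the line `x`. The given points may coincide, and then a second point
    -- results; `commonOpposite` is likewise used with the same line twice.
    thirdPoint : ∀ x {a b} → a ∈ x → b ∈ x →
                 ∃[ c ] c ∈ x × ¬ (a ≈ c) × ¬ (b ≈ c)
    thirdPoint x {a} {b} a∈x b∈x
      with opp-plump (inj₂ x) (inj₁ a ∷ inj₁ b ∷ []) (s≤s (s≤s z≤n)) (a∈x ∷ b∈x ∷ [])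
    ... | inj₂ y , x~y , _             = contradiction x~y (proj₂ bipartition x y)
    ... | inj₁ c , c∈x , (o ∷ o′ ∷ []) =
      c , c∈x , (λ e → opp-antireflex _ (inj₁ e) o) , (λ e → opp-antireflex _ (inj₁ e) o′)

  pointOn : ∀ x → ∃[ a ] a ∈ x
  pointOn x with opp-plump (inj₂ x) [] z≤n []
  ... | inj₁ a , a∈x , _ = a , a∈x
  ... | inj₂ y , x~y , _ = contradiction x~y (proj₂ bipartition x y)

  isThick : IsThick S
  isThick x with pointOn x
  ... | a , a∈x with thirdPoint x a∈x a∈x
  ... | b , b∈x , a≉b , _ with thirdPoint x a∈x b∈x
  ... | c , c∈x , a≉c , b≉c = a , b , c , a∈x , b∈x , c∈x , a≉b , b≉c , a≉c

  -- Projections and opposite points, from (VP2) and (VP3).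

  abstract
    -- (VP2) for k = 2: by greenness (a, x, b) and (a, y, b) are straight.
    line-unique : ∀ {a b x y} → ¬ (a ≈ b) → a ∈ x → b ∈ x → a ∈ y → b ∈ y → x ≈ˡ y
    line-unique {a} {b} {x} {y} a≉b a∈x b∈x a∈y b∈y = drop-inj₂
      (proj₂ (VP2 2 (s≤s z≤n) (s≤s (s≤s (s≤s z≤n))) _ (path a∈y b∈y)
                  2 ≤-refl _ (path a∈x b∈x) ≈ᵛ-refl ≈ᵛ-refl) 1 (s≤s z≤n))
      where
      path : ∀ {z} → a ∈ z → b ∈ z →
             IsStraight Γ 2 (cons (inj₁ a) (cons (inj₂ z) (const (inj₁ b))))
      path a∈z b∈z = straight-cons Γ isVeldkampGraph (distinct a∈z b∈z a≉b) (straight-edge Γ b∈z)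

  -- A straight 3-path (a , side , foot , x).
  record Projection (a : Point) (x : Line) : Set ℓ where
    constructor projection
    field
      {side}    : Line
      {foot}    : Point
      a∈side    : a ∈ side
      foot∈side : foot ∈ side
      a≉foot    : ¬ (a ≈ foot)
      opposed   : OppAt foot side x

    foot∈x : foot ∈ x
    foot∈x = OppAt⇒∈₂ opposed

    a⟂foot : a ⟂ₛ foot
    a⟂foot = inj₂ (side , a∈side , foot∈side)

    path : ℕ → Vertex
    path = cons (inj₁ a) (cons (inj₂ side) (cons (inj₁ foot) (const (inj₂ x))))

    isStraight : IsStraight Γ 3 path
    isStraight =
      straight-cons Γ isVeldkampGraph (distinct a∈side foot∈side a≉foot)
        (straight-cons Γ isVeldkampGraph opposed (straight-edge Γ (~-sym foot∈x)))

  open Projection using (side; foot; a∈side; foot∈side; a≉foot; foot∈x; a⟂foot; opposed)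

  -- (VP2) for k = 3; the feet are the vertices with index 2 of two straight paths.
  foot-unique : ∀ {a x} (π ρ : Projection a x) → foot π ≈ foot ρ
  foot-unique π ρ = drop-inj₁
    (proj₂ (VP2 3 (s≤s z≤n) ≤-refl _ (Projection.isStraight ρ)
                3 ≤-refl _ (Projection.isStraight π) ≈ᵛ-refl ≈ᵛ-refl) 2 (s≤s (s≤s z≤n)))

  -- (VP2) for k = 3: an incidence would be a straight 1-path with the same ends.
  projection⇒∉ : ∀ {a x} → Projection a x → ¬ (a ∈ x)
  projection⇒∉ {a} {x} π a∈x
    with () ← proj₁ (VP2 3 (s≤s z≤n) ≤-refl _ (Projection.isStraight π)
                         1 (s≤s z≤n) (cons (inj₁ a) (const (inj₂ x)))
                         (straight-edge Γ (~-sym a∈x)) ≈ᵛ-refl ≈ᵛ-refl)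

  -- A straight 4-path (a , side , foot , end , c), so that a and c are opposite.
  record _⟂̸_ (a c : Point) : Set ℓ where
    constructor opposite
    field
      {end}   : Line
      π       : Projection a end
      c∈end   : c ∈ end
      foot≉c  : ¬ (foot π ≈ c)

  ⟂̸-sym : ∀ {a c} → a ⟂̸ c → c ⟂̸ a
  ⟂̸-sym (opposite (projection p q a≉b o) c∈x b≉c) =
    opposite (projection c∈x (OppAt⇒∈₂ o) (b≉c ∘ ≈-sym) (opp-sym _ o)) p (a≉b ∘ ≈-sym)

  ⟂̸-resp : ∀ {a c c′} → c ≈ c′ → a ⟂̸ c → a ⟂̸ c′
  ⟂̸-resp e (opposite π c∈x b≉c) =
    opposite π (∈-resp e c∈x) (λ e′ → b≉c (≈-trans e′ (≈-sym e)))

  ⟂̸-corner : ∀ {a b c x y} → OppAt b x y → a ∈ x → c ∈ y →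
              ¬ (a ≈ b) → ¬ (b ≈ c) → a ⟂̸ c
  ⟂̸-corner o a∈x c∈y a≉b b≉c = opposite (projection a∈x (OppAt⇒∈₁ o) a≉b o) c∈y b≉c

  ⟂̸-path : ∀ {a c} → a ⟂̸ c → ℕ → Vertex
  ⟂̸-path {a} {c} (opposite {x} π _ _) =
    cons (inj₁ a) (cons (inj₂ (side π)) (cons (inj₁ (foot π)) (cons (inj₂ x) (const (inj₁ c)))))

  ⟂̸-straight : ∀ {a c} (o : a ⟂̸ c) → IsStraight Γ 4 (⟂̸-path o)
  ⟂̸-straight {a} {c} (opposite π c∈x b≉c) =
    straight-cons Γ isVeldkampGraph (distinct (a∈side π) (foot∈side π) (a≉foot π))
      (straight-cons Γ isVeldkampGraph (opposed π)
        (straight-cons Γ isVeldkampGraph (distinct (foot∈x π) c∈x b≉c) (straight-edge Γ c∈x)))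

  -- In the circuit of `project-opposed`, the vertices v₈, v₇, v₆, v₅ form a projection of `a` onto
  -- `w` with foot v₆, which differs from v₄ and so from `c`. The vertices are separate arguments so
  -- that they can be matched against the bipartition.
  readProjection : ∀ {a c w} v₄ v₅ v₆ v₇ v₈ → v₄ ≈ᵛ inj₁ c → v₅ ≈ᵛ inj₂ w → v₈ ≈ᵛ inj₁ a →
    v₇ ~ v₈ → ¬ (v₄ ≈ᵛ v₆) → ¬ (v₆ ≈ᵛ v₈) → Opp v₆ v₅ v₇ →
    Σ[ π ∈ Projection a w ] ¬ (foot π ≈ c)
  readProjection _ (inj₂ _) (inj₁ d) (inj₂ u) _ e₄ e₅ e₈ s₇ t₄ t₆ o =
    projection (~-resp ≈ᵛ-refl e₈ s₇) (~-sym (proj₂ (Opp-support o)))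
               (λ e → t₆ (≈ᵛ-trans (inj₁ (≈-sym e)) (≈ᵛ-sym e₈)))
               (opp-sym _ (Opp-resp ≈ᵛ-refl e₅ ≈ᵛ-refl o)) ,
    (λ e → t₄ (≈ᵛ-trans e₄ (inj₁ (≈-sym e))))
  readProjection _ (inj₂ x) (inj₂ y) _ _ _ _ _ _ _ _ o =
    contradiction (proj₁ (Opp-support o)) (proj₂ bipartition y x)
  readProjection _ _ (inj₁ a) (inj₁ b) _ _ _ _ _ _ _ o =
    contradiction (proj₂ (Opp-support o)) (proj₁ bipartition a b)

  -- Appending `w` to the root from `a` to `c` gives a straight 5-path, which (VP3) puts into a
  -- straight 8-circuit. The rest of the circuit leads from `w` back to `a` in three steps.
  project-opposed : ∀ {a c} (o : a ⟂̸ c) {w} → OppAt c (_⟂̸_.end o) w →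
                    Σ[ π ∈ Projection a w ] ¬ (foot π ≈ c)
  project-opposed {a} {c} (opposite {x} π c∈x b≉c) {w} o =
    readProjection (C (j + 4)) (C (j + 5)) (C (j + 6)) (C (j + 7)) (C (j + 8))
      (≈ᵛ-sym (lies 4 (s≤s (s≤s (s≤s (s≤s z≤n)))))) (≈ᵛ-sym (lies 5 ≤-refl))
      (≈ᵛ-trans period (≈ᵛ-sym (lies 0 z≤n)))
      (proj₁ (proj₁ window) 7 ≤-refl) (proj₂ (proj₁ window) 4 (s≤s (s≤s (s≤s (s≤s (s≤s (s≤s z≤n)))))))
      (proj₂ (proj₁ window) 6 ≤-refl) (proj₂ window 5 (s≤s (s≤s (s≤s (s≤s (s≤s (s≤s (s≤s z≤n))))))))
    where
    straight : IsStraight Γ 5 _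
    straight =
      straight-cons Γ isVeldkampGraph (distinct (a∈side π) (foot∈side π) (a≉foot π))
        (straight-cons Γ isVeldkampGraph (opposed π)
          (straight-cons Γ isVeldkampGraph {u = inj₁ (foot π)}
            {p = cons (inj₂ x) (cons (inj₁ c) (const (inj₂ w)))} (distinct (foot∈x π) c∈x b≉c)
            (straight-cons Γ isVeldkampGraph o (straight-edge Γ (~-sym (OppAt⇒∈₂ o))))))
    circuit = VP3 _ straight
    C = proj₁ circuit
    j = proj₁ (proj₂ (proj₂ circuit))
    lies = proj₂ (proj₂ (proj₂ circuit))
    window : IsStraight Γ 8 (shift Γ j C)
    window = proj₂ (proj₁ (proj₂ circuit)) j 8
    -- Periodicity is stated for `8 + j`, while the window starting at `j` ends at `j + 8`.
    period : C (j + 8) ≈ᵛ C (j + 0)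
    period rewrite +-comm j 8 | +-comm j 0 = proj₁ (proj₂ (proj₁ (proj₁ (proj₂ circuit)))) j

  -- Let `z` join `a` and `c`, and let `w` be opposite at `c` to both `z` and the last line of the
  -- root. Then (a, z, c, w) is a projection with foot `c`, but `project-opposed` yields one with
  -- another foot.
  ⟂̸⇒¬⟂ : ∀ {a c} → a ⟂̸ c → ¬ (a ⟂ₛ c)
  ⟂̸⇒¬⟂ (opposite π c∈x _) (inj₁ a≈c) = projection⇒∉ π (∈-resp (≈-sym a≈c) c∈x)
  ⟂̸⇒¬⟂ {a} {c} o@(opposite {x} _ c∈x _) (inj₂ (z , a∈z , c∈z))
    with commonOpposite x z c∈x c∈z
  ... | w , x-w , z-w with project-opposed o x-w
  ... | π , foot≉c = foot≉c (foot-unique π (projection a∈z c∈z a≉c z-w))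
    where
    a≉c : ¬ (a ≈ c)
    a≉c e = ⟂̸⇒¬⟂ o (inj₁ e)

  abstract
    -- An arbitrary `w` is reached through a line `w′` opposite at `c` to both `x` and `w`: the
    -- projection onto `w′` extends to a new root from `a` to `c`, and `project-opposed` applies to
    -- that root and `w`.
    project : ∀ {a c w} → a ⟂̸ c → c ∈ w → Σ[ π ∈ Projection a w ] ¬ (foot π ≈ c)
    project {w = w} o@(opposite {x} _ c∈x _) c∈w with commonOpposite x w c∈x c∈w
    ... | w′ , x-w′ , w-w′ with project-opposed o x-w′
    ... | π , foot≉c = project-opposed (opposite π (OppAt⇒∈₂ x-w′) foot≉c) (opp-sym _ w-w′)

  -- Every other point of `x` ends a root through the foot, so it is opposite `a`.
  ⟂⇒foot : ∀ {a x b} (π : Projection a x) → b ∈ x → a ⟂ₛ b → b ≈ foot π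
  ⟂⇒foot {b = b} π b∈x a⟂b with em {foot π ≈ b}
  ... | yes e      = ≈-sym e
  ... | no  foot≉b = contradiction a⟂b (⟂̸⇒¬⟂ (opposite π b∈x foot≉b))

  existsOpposite : ∀ a → ∃[ c ] a ⟂̸ c
  existsOpposite a with lineThrough a
  ... | x , a∈x with thirdPoint x a∈x a∈x
  ... | b , b∈x , a≉b , _ with commonOpposite x x b∈x b∈x
  ... | y , x-y , _ with thirdPoint y (OppAt⇒∈₂ x-y) (OppAt⇒∈₂ x-y)
  ... | c , c∈y , b≉c , _ = c , ⟂̸-corner x-y a∈x c∈y a≉b b≉c

  -- Points that are neither collinear nor opposite.

  -- In the end there are no near points, by `reach`.
  Near : Point → Point → Set ℓ
  Near d e = ¬ (d ⟂ₛ e) × ¬ (d ⟂̸ e)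

  near-sym : ∀ {d e} → Near d e → Near e d
  near-sym (¬d⟂e , ¬d-e) = ¬d⟂e ∘ ⟂-sym S , ¬d-e ∘ ⟂̸-sym

  ¬near⇒⟂-or-⟂̸ : ∀ {d e} → ¬ Near d e → d ⟂ₛ e ⊎ d ⟂̸ e
  ¬near⇒⟂-or-⟂̸ {d} {e} ¬near with em {d ⟂ₛ e} | em {d ⟂̸ e}
  ... | yes p | _     = inj₁ p
  ... | no _  | yes q = inj₂ q
  ... | no p  | no q  = contradiction (p , q) ¬near

  -- If `e` were opposite `q`, it would project onto the line `qd`: either to `d`, making `d` and
  -- `e` collinear, or to another point, making them opposite.
  near⇒¬⟂̸ : ∀ {d e q} → Near d e → q ⟂ₛ d → ¬ (e ⟂̸ q)
  near⇒¬⟂̸ (_ , ¬d-e) (inj₁ q≈d) e-q = ¬d-e (⟂̸-sym (⟂̸-resp q≈d e-q))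
  near⇒¬⟂̸ {d} (¬d⟂e , ¬d-e) (inj₂ (s , q∈s , d∈s)) e-q with project e-q q∈s
  ... | π , _ with em {foot π ≈ d}
  ... | yes b≈d = ¬d⟂e (⟂-sym S (⟂-respʳ S b≈d (a⟂foot π)))
  ... | no  b≉d = ¬d-e (⟂̸-sym (opposite π d∈s b≉d))

  -- On the line joining `i` and `g`, the point `e` projects to `i`; otherwise `e` and `i` would be
  -- opposite, against `near⇒¬⟂̸`.
  near-⟂ : ∀ {d e g i} → Near d e → e ⟂̸ g → i ⟂ₛ d → i ⟂ₛ g → i ⟂ₛ e
  near-⟂ near e-g i⟂d (inj₁ i≈g) =
    contradiction (⟂̸-resp (≈-sym i≈g) e-g) (near⇒¬⟂̸ near i⟂d)
  near-⟂ {i = i} near e-g i⟂d (inj₂ (t , i∈t , g∈t)) with project e-g g∈t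
  ... | π , _ with em {foot π ≈ i}
  ... | yes j≈i = ⟂-sym S (⟂-respʳ S j≈i (a⟂foot π))
  ... | no  j≉i = contradiction (opposite π i∈t j≉i) (near⇒¬⟂̸ near i⟂d)

  -- By `near⇒¬⟂̸`, `f` is not opposite `i`. If they were not collinear either, they would be near,
  -- and then `d` ⟂ `i` would prevent `f` from being opposite `d`.
  near-near-⟂ : ∀ {d e f i} → Near d e → Near e f → d ⟂̸ f → i ⟂ₛ d → i ⟂ₛ e → i ⟂ₛ f
  near-near-⟂ {f = f} {i} de ef d-f i⟂d i⟂e with em {i ⟂ₛ f}
  ... | yes i⟂f = i⟂f
  ... | no ¬i⟂f = contradiction (⟂̸-sym d-f)
    (near⇒¬⟂̸ (¬i⟂f , λ i-f → near⇒¬⟂̸ ef i⟂e (⟂̸-sym i-f)) (⟂-sym S i⟂d))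

  -- Let g be opposite to d and e on a line through h, and let e′ be a third
  -- point on the line eh.  Then e′ ⟂ d, and the point i of the line de′ with
  -- i ⟂ g also satisfies i ⟂ f.  Since d and f are opposite, i = e′, so
  -- e′ ⟂ g, although e′ and g are opposite.
  near-near-⟂̸ : ∀ {d e f h} → Near d e → Near e f → d ⟂ₛ h → e ⟂ₛ h → ¬ (d ⟂̸ f)
  near-near-⟂̸ {d} {e} {f} {h} de@(¬d⟂e , _) ef d⟂h e⟂h d-f =
    ⟂̸⇒¬⟂ (⟂̸-corner y-t e′∈y g∈t (h≉e′ ∘ ≈-sym) h≉g) (⟂-sym S (⟂-respʳ S i≈e′ (a⟂foot ρ)))
    where
    d≉h : ¬ (d ≈ h)
    d≉h d≈h = ¬d⟂e (⟂-sym S (⟂-respʳ S (≈-sym d≈h) e⟂h))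
    e≉h : ¬ (e ≈ h)
    e≉h e≈h = ¬d⟂e (⟂-respʳ S (≈-sym e≈h) d⟂h)

    s∋ = ⟂-joined S d≉h d⟂h
    s = proj₁ s∋
    y∋ = ⟂-joined S e≉h e⟂h
    y = proj₁ y∋
    e∈y = proj₁ (proj₂ y∋)

    t∋ = commonOpposite y s (proj₂ (proj₂ y∋)) (proj₂ (proj₂ s∋))
    t = proj₁ t∋
    y-t = proj₁ (proj₂ t∋)
    s-t = proj₂ (proj₂ t∋)
    g∋ = thirdPoint t (OppAt⇒∈₂ y-t) (OppAt⇒∈₂ y-t)
    g = proj₁ g∋
    g∈t = proj₁ (proj₂ g∋)
    h≉g = proj₁ (proj₂ (proj₂ g∋))

    e-g : e ⟂̸ g
    e-g = ⟂̸-corner y-t e∈y g∈t e≉h h≉g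
    d-g : d ⟂̸ g
    d-g = ⟂̸-corner s-t (proj₁ (proj₂ s∋)) g∈t d≉h h≉g

    -- The point `h′` serves to show `d` ⟂ `e′`: it is collinear with `d` and opposite `e′`, so `d`
    -- and `e′` are not near; nor are they opposite, because `e` ⟂ `e′`.
    y′∋ = commonOpposite y y e∈y e∈y
    y-y′ = proj₁ (proj₂ y′∋)
    π∋ = project (⟂̸-sym e-g) (OppAt⇒∈₂ y-y′)
    π = proj₁ π∋
    h′ = foot π

    h′⟂d : h′ ⟂ₛ d
    h′⟂d = near-⟂ (near-sym de) d-g (inj₂ (_ , foot∈x π , OppAt⇒∈₂ y-y′)) (⟂-sym S (a⟂foot π))

    e′∋ = thirdPoint y e∈y (proj₂ (proj₂ y∋))
    e′ = proj₁ e′∋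
    e′∈y = proj₁ (proj₂ e′∋)
    h≉e′ = proj₂ (proj₂ (proj₂ e′∋))
    e⟂e′ : e ⟂ₛ e′
    e⟂e′ = inj₂ (y , e∈y , e′∈y)

    e′-h′ : e′ ⟂̸ h′
    e′-h′ = ⟂̸-corner y-y′ e′∈y (foot∈x π)
              (proj₁ (proj₂ (proj₂ e′∋)) ∘ ≈-sym) (proj₂ π∋ ∘ ≈-sym)

    d⟂e′ : d ⟂ₛ e′
    d⟂e′ with ¬near⇒⟂-or-⟂̸ {d} {e′} (λ de′ → near⇒¬⟂̸ de′ h′⟂d e′-h′)
    ... | inj₁ d⟂e′ = d⟂e′
    ... | inj₂ d-e′ = contradiction d-e′ (near⇒¬⟂̸ (near-sym de) (⟂-sym S e⟂e′))

    s′∋ = ⟂-joined S (λ d≈e′ → ¬d⟂e (⟂-sym S (⟂-respʳ S (≈-sym d≈e′) e⟂e′))) d⟂e′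
    d∈s′ = proj₁ (proj₂ s′∋)
    e′∈s′ = proj₂ (proj₂ s′∋)
    ρ = proj₁ (project (⟂̸-sym d-g) d∈s′)
    σ = proj₁ (project (⟂̸-sym d-f) d∈s′)
    i⟂d : foot ρ ⟂ₛ d
    i⟂d = inj₂ (_ , foot∈x ρ , d∈s′)

    i≈e′ : foot ρ ≈ e′
    i≈e′ = ≈-trans
      (⟂⇒foot σ (foot∈x ρ)
        (⟂-sym S (near-near-⟂ de ef d-f i⟂d (near-⟂ de e-g i⟂d (⟂-sym S (a⟂foot ρ))))))
      (≈-sym (⟂⇒foot σ e′∈s′
        (⟂-sym S (near-near-⟂ de ef d-f (⟂-sym S d⟂e′) (⟂-sym S e⟂e′)))))

  -- Flatness excludes near points with a common neighbour.

  ⟂̸⇒Opposite : ∀ {a c v} → v ≈ᵛ inj₁ c → a ⟂̸ c → Opposite Γ 4 (inj₁ a) v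
  ⟂̸⇒Opposite e o = ⟂̸-path o , ⟂̸-straight o , ≈ᵛ-refl , ≈ᵛ-sym e

  abstract
    -- A root has even length, so if it starts at a point it ends at one; all other patterns
    -- contradict `bipartition`.
    Opposite⇒⟂̸ : ∀ {a v} → Opposite Γ 4 (inj₁ a) v → ∃[ c ] v ≈ᵛ inj₁ c × a ⟂̸ c
    Opposite⇒⟂̸ {a} {v} (p , (_ , opp) , e₀ , e₄) =
      read (p 0) (p 1) (p 2) (p 3) (p 4) e₀ (≈ᵛ-sym e₄) (opp 0 (s≤s (s≤s z≤n)))
           (opp 1 (s≤s (s≤s (s≤s z≤n)))) (opp 2 (s≤s (s≤s (s≤s (s≤s z≤n)))))
      where
      read : ∀ v₀ v₁ v₂ v₃ v₄ → v₀ ≈ᵛ inj₁ a → v ≈ᵛ v₄ →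
             Opp v₁ v₀ v₂ → Opp v₂ v₁ v₃ → Opp v₃ v₂ v₄ → ∃[ c ] v ≈ᵛ inj₁ c × a ⟂̸ c
      read (inj₁ _) (inj₂ x) (inj₁ b) (inj₂ y) (inj₁ c) (inj₁ e₀) e₄ o₁ o₂ o₃ =
        c , e₄ , ⟂̸-corner o₂ (∈-resp e₀ (proj₁ (Opp-support o₁))) (proj₂ (Opp-support o₃))
          (λ a≈b → opp-antireflex _ (inj₁ (≈-trans e₀ a≈b)) o₁)
          (λ b≈c → opp-antireflex _ (inj₁ b≈c) o₃)
      read (inj₁ b) (inj₁ c) _ _ _ _ _ o₁ _ _ =
        contradiction (proj₁ (Opp-support o₁)) (proj₁ bipartition c b)
      read _ (inj₂ x) (inj₂ y) _ _ _ _ o₁ _ _ =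
        contradiction (proj₂ (Opp-support o₁)) (proj₂ bipartition x y)
      read _ _ (inj₁ b) (inj₁ c) _ _ _ _ o₂ _ =
        contradiction (proj₂ (Opp-support o₂)) (proj₁ bipartition b c)
      read _ _ _ (inj₂ x) (inj₂ y) _ _ _ _ o₃ =
        contradiction (proj₂ (Opp-support o₃)) (proj₂ bipartition x y)

  abstract
    -- A point opposite `d` cannot be collinear with `e`, by `near⇒¬⟂̸`, nor near `e`, by
    -- `near-near-⟂̸`.
    near⇒op⊆op : ∀ {d e h} → Near d e → d ⟂ₛ h → e ⟂ₛ h →
                 ∀ {v} → Opposite Γ 4 (inj₁ d) v → Opposite Γ 4 (inj₁ e) v
    near⇒op⊆op {d} {e} de d⟂h e⟂h opp with Opposite⇒⟂̸ opp
    ... | c , v≈c , d-c =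
      [ (λ e⟂c → contradiction d-c (near⇒¬⟂̸ (near-sym de) (⟂-sym S e⟂c)))
      , ⟂̸⇒Opposite v≈c
      ]′ (¬near⇒⟂-or-⟂̸ (λ ec → near-near-⟂̸ de ec d⟂h e⟂h d-c))

  abstract
    -- If `d` and `e` were near, they would have the same opposite vertices, so they would be equal
    -- by flatness and hence collinear.
    ⟂-or-⟂̸ : ∀ {d e h} → d ⟂ₛ h → e ⟂ₛ h → d ⟂ₛ e ⊎ d ⟂̸ e
    ⟂-or-⟂̸ d⟂h e⟂h = ¬near⇒⟂-or-⟂̸ λ de → proj₁ de (inj₁ (drop-inj₁ (flat _ _ λ v →
      mk⇔ (near⇒op⊆op de d⟂h e⟂h) (near⇒op⊆op (near-sym de) e⟂h d⟂h))))

  -- As `d` ⟂ `c`, the projection of `d` onto `y` has foot `c`; its side is `z` by `line-unique`, so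
  -- its straightness at the foot is the claim.
  ⟂̸⇒OppAt : ∀ {c d e y z} → c ∈ z → c ∈ y → d ∈ z → e ∈ y → d ⟂̸ e → OppAt c z y
  ⟂̸⇒OppAt {c} {d} {z = z} c∈z c∈y d∈z e∈y d-e =
    Opp-resp (inj₁ (≈-sym c≈b)) (inj₂ side≈z) ≈ᵛ-refl (opposed π)
    where
    π = proj₁ (project d-e e∈y)
    c≈b : c ≈ foot π
    c≈b = ⟂⇒foot π c∈y (inj₂ (z , d∈z , c∈z))
    d≉c : ¬ (d ≈ c)
    d≉c d≈c = a≉foot π (≈-trans d≈c c≈b)
    side≈z : side π ≈ˡ z
    side≈z = line-unique d≉c (a∈side π) (∈-resp (≈-sym c≈b) (foot∈side π)) d∈z c∈z

  ¬OppAt⇒⟂ : ∀ {c d e y z} → c ∈ z → c ∈ y → ¬ OppAt c z y → d ∈ z → e ∈ y → d ⟂ₛ e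
  ¬OppAt⇒⟂ {y = y} {z} c∈z c∈y ¬o d∈z e∈y =
    [ id , (λ d-e → contradiction (⟂̸⇒OppAt c∈z c∈y d∈z e∈y d-e) ¬o) ]′
      (⟂-or-⟂̸ (inj₂ (z , d∈z , c∈z)) (inj₂ (y , e∈y , c∈y)))

  -- The polar space axioms.

  -- The invariant carried along paths from `a`. At a line it is the alternative in the polar space
  -- axiom, the unique collinear point being the foot of a projection.
  Reach : Point → Vertex → Set ℓ
  Reach a (inj₁ c) = a ⟂ₛ c ⊎ a ⟂̸ c
  Reach a (inj₂ x) = Projection a x ⊎ (∀ {b} → b ∈ x → a ⟂ₛ b)

  reach-resp : ∀ {a u v} → u ≈ᵛ v → Reach a u → Reach a v
  reach-resp (inj₁ e) (inj₁ p) = inj₁ (⟂-respʳ S e p)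
  reach-resp (inj₁ e) (inj₂ o) = inj₂ (⟂̸-resp e o)
  reach-resp (inj₂ e) (inj₁ (projection p q n o)) =
    inj₁ (projection p q n (Opp-resp ≈ᵛ-refl ≈ᵛ-refl (inj₂ e) o))
  reach-resp (inj₂ e) (inj₂ all) = inj₂ (λ b∈y → all (∈-respˡ (≈ˡ-sym e) b∈y))

  -- From a point opposite `a`, `project` applies. From a point `c` collinear with but distinct from
  -- `a`, the outcome depends on whether the line `ac` is opposite `w` at `c`.
  reach-step : ∀ {a} u v → u ~ v → Reach a u → Reach a v
  reach-step (inj₁ b) (inj₁ c) s _ = contradiction s (proj₁ bipartition b c)
  reach-step (inj₂ x) (inj₂ y) s _ = contradiction s (proj₂ bipartition x y)
  reach-step (inj₁ c) (inj₂ w) s (inj₂ a-c) = inj₁ (proj₁ (project a-c (~-sym s)))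
  reach-step {a} (inj₁ c) (inj₂ w) s (inj₁ a⟂c) with em {a ≈ c}
  ... | yes a≈c = inj₂ (λ b∈w → inj₂ (w , ∈-resp (≈-sym a≈c) (~-sym s) , b∈w))
  ... | no a≉c with ⟂-joined S a≉c a⟂c
  ... | z , a∈z , c∈z with em {OppAt c z w}
  ... | yes z-w = inj₁ (projection a∈z c∈z a≉c z-w)
  ... | no ¬z-w = inj₂ (¬OppAt⇒⟂ c∈z (~-sym s) ¬z-w a∈z)
  reach-step (inj₂ x) (inj₁ c) s (inj₂ all) = inj₁ (all s)
  reach-step (inj₂ x) (inj₁ c) s (inj₁ π) with em {foot π ≈ c}
  ... | yes b≈c = inj₁ (⟂-respʳ S b≈c (a⟂foot π))
  ... | no  b≉c = inj₂ (opposite π s b≉c)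

  abstract
    reach : ∀ a v → Reach a v
    reach a v with proj₂ (proj₁ VP1) (inj₁ a) v
    ... | n , p , (edge , _) , e₀ , eₙ = reach-resp eₙ (walk n ≤-refl)
      where
      walk : ∀ i → i ≤ n → Reach a (p i)
      walk zero    _   = reach-resp (≈ᵛ-sym e₀) (inj₁ (inj₁ ≈-refl))
      walk (suc i) i<n = reach-step (p i) (p (suc i)) (edge i i<n) (walk i (<⇒≤ i<n))

  isPolarSpace : IsPolarSpace S
  isPolarSpace = record
    { isLineSpace = λ x → let a , b , _ , a∈x , b∈x , _ , a≉b , _ = isThick x in
                          a , b , a∈x , b∈x , a≉b
    ; oneOrAll    = oneOrAll
    }
    where
    oneOrAll : ∀ a x →
      (∃[ b ] b ∈ x × a ⟂ₛ b × (∀ c → c ∈ x → a ⟂ₛ c → c ≈ b)) ⊎ (∀ b → b ∈ x → a ⟂ₛ b)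
    oneOrAll a x with reach a (inj₂ x)
    ... | inj₁ π   = inj₁ (foot π , foot∈x π , a⟂foot π , λ _ → ⟂⇒foot π)
    ... | inj₂ all = inj₂ (λ _ → all)

  isNonDegenerate : IsNonDegenerate S
  isNonDegenerate a a⟂ with existsOpposite a
  ... | c , a-c = ⟂̸⇒¬⟂ a-c (a⟂ c)

  someLine : Line
  someLine with proj₁ (proj₁ VP1)
  ... | inj₁ a = proj₁ (lineThrough a)
  ... | inj₂ x = x

  -- The isomorphism with the incidence graph of `S`.

  line-injective : ∀ {x y} → (λ a → a ∈ x) ≐ (λ a → a ∈ y) → x ≈ˡ y
  line-injective {x} (x⊆y , _) with isThick x
  ... | a , b , _ , a∈x , b∈x , _ , a≉b , _ = line-unique a≉b a∈x b∈x (x⊆y a∈x) (x⊆y b∈x)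

  OppAt⇒¬singular : ∀ {a x y} → OppAt a x y →
                    ¬ IsSingular S (⟨_⟩ S ((λ b → b ∈ x) ∪ (λ b → b ∈ y)))
  OppAt⇒¬singular {a} {x} {y} o sing
    with thirdPoint x (OppAt⇒∈₁ o) (OppAt⇒∈₁ o) | thirdPoint y (OppAt⇒∈₂ o) (OppAt⇒∈₂ o)
  ... | b , b∈x , a≉b , _ | c , c∈y , a≉c , _ =
    ⟂̸⇒¬⟂ (⟂̸-corner o b∈x c∈y (a≉b ∘ ≈-sym) a≉c) (sing (incl (inj₁ b∈x)) (incl (inj₂ c∈y)))

  -- The union of the two lines is already singular by `¬OppAt⇒⟂`, and `⟨⟩-singular` passes this to
  -- its span.
  ¬OppAt⇒singular : ∀ {a x y} → a ∈ x → a ∈ y → ¬ OppAt a x y →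
                    IsSingular S (⟨_⟩ S ((λ b → b ∈ x) ∪ (λ b → b ∈ y)))
  ¬OppAt⇒singular {a} {x} {y} a∈x a∈y ¬o = ⟨⟩-singular S isPolarSpace λ
    { (inj₁ p) (inj₁ q) → inj₂ (x , p , q)
    ; (inj₁ p) (inj₂ q) → ¬OppAt⇒⟂ a∈x a∈y ¬o p q
    ; (inj₂ p) (inj₁ q) → ⟂-sym S (¬OppAt⇒⟂ a∈x a∈y ¬o q p)
    ; (inj₂ p) (inj₂ q) → inj₂ (y , p , q)
    }

  isIsomorphism : IsIsomorphism Γ (incidenceGraph S) (canonicalMap Γ)
  isIsomorphism = record
    { cong       = λ { (inj₁ e) → inj₁ e
                     ; (inj₂ e) → inj₂ (∈-respˡ e , ∈-respˡ (≈ˡ-sym e)) }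
    ; injective  = λ { {inj₁ _} {inj₁ _} (inj₁ e) → inj₁ e
                     ; {inj₂ _} {inj₂ _} (inj₂ e) → inj₂ (line-injective e) }
    ; surjective = λ { (inj₁ a) → inj₁ a , λ { (inj₁ e) → inj₁ e }
                     ; (inj₂ x) → inj₂ x , λ { (inj₂ e) → inj₂ (∈-respˡ e , ∈-respˡ (≈ˡ-sym e)) } }
    ; adjacency  = adjacency
    ; opposition = opposition
    }
    where
    module Δ = OppGraph (incidenceGraph S)
    f = canonicalMap Γ

    adjacency : ∀ u v → (u ~ v) ⇔ (f u Δ.~ f v)
    adjacency (inj₁ a) (inj₂ x) = mk⇔ ~-sym ~-sym
    adjacency (inj₂ x) (inj₁ a) = mk⇔ (λ s → s) (λ s → s)
    adjacency (inj₁ a) (inj₁ b) = mk⇔ (λ s → contradiction s (proj₁ bipartition a b)) (λ ())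
    adjacency (inj₂ x) (inj₂ y) = mk⇔ (λ s → contradiction s (proj₂ bipartition x y)) (λ ())

    opposition : ∀ v x y → Opp v x y ⇔ Δ.Opp (f v) (f x) (f y)
    opposition (inj₁ a) (inj₂ x) (inj₂ y) =
      mk⇔ (λ o → OppAt⇒∈₁ o , OppAt⇒∈₂ o , OppAt⇒¬singular o) back
      where
      back : Δ.Opp (inj₁ a) (inj₂ x) (inj₂ y) → OppAt a x y
      back (a∈x , a∈y , ¬sing) with em {OppAt a x y}
      ... | yes o = o
      ... | no ¬o = ⊥-elim (¬sing (¬OppAt⇒singular a∈x a∈y ¬o))
    opposition (inj₂ x) (inj₁ a) (inj₁ b) =
      mk⇔ (λ o → proj₁ (Opp-support o) , proj₂ (Opp-support o) ,
                 λ e → opp-antireflex _ (inj₁ e) o)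
          (λ (a∈x , b∈x , a≉b) → distinct a∈x b∈x a≉b)
    opposition (inj₁ a) (inj₁ b) _ =
      mk⇔ (λ o → contradiction (proj₁ (Opp-support o)) (proj₁ bipartition a b)) (λ ())
    opposition (inj₁ a) (inj₂ _) (inj₁ b) =
      mk⇔ (λ o → contradiction (proj₂ (Opp-support o)) (proj₁ bipartition a b)) (λ ())
    opposition (inj₂ x) (inj₂ y) _ =
      mk⇔ (λ o → contradiction (proj₁ (Opp-support o)) (proj₂ bipartition x y)) (λ ())
    opposition (inj₂ x) (inj₁ _) (inj₂ y) =
      mk⇔ (λ o → contradiction (proj₂ (Opp-support o)) (proj₂ bipartition x y)) (λ ())

  -- Generalized quadrangles and rank 2.

  open Rank em S isPolarSpace

  isPoint : Vertex → Bool
  isPoint = [ const true , const false ]′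

  isPoint-resp : ∀ {u v} → u ≈ᵛ v → isPoint u ≡ isPoint v
  isPoint-resp (inj₁ _) = refl
  isPoint-resp (inj₂ _) = refl

  isPoint-flip : ∀ u v → u ~ v → isPoint v ≡ not (isPoint u)
  isPoint-flip (inj₁ a) (inj₁ b) s = contradiction s (proj₁ bipartition a b)
  isPoint-flip (inj₁ a) (inj₂ x) s = refl
  isPoint-flip (inj₂ x) (inj₁ a) s = refl
  isPoint-flip (inj₂ x) (inj₂ y) s = contradiction s (proj₂ bipartition x y)

  -- Colours alternate, so equal colours at both ends force even length; this excludes odd circuits
  -- and odd distances between points.
  isPoint-walk : ∀ (p : ℕ → Vertex) n → (∀ i → i < n → p i ~ p (suc i)) →
                 isPoint (p n) ≡ fold (isPoint (p 0)) not n
  isPoint-walk p zero    _    = refl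
  isPoint-walk p (suc n) edge = ≡-trans (isPoint-flip _ _ (edge n ≤-refl))
    (cong not (isPoint-walk p n (λ i i<n → edge i (m<n⇒m<1+n i<n))))

  isBipartite : Bipartite Γ
  isBipartite = isPoint , isPoint-resp , λ {u} {v} s e →
    flips (isPoint u) (≡-trans e (isPoint-flip u v s))
    where
    flips : ∀ b → b ≢ not b
    flips true  ()
    flips false ()

  _⟶_ : Vertex → Vertex → Set ℓ
  u ⟶ v = ∃[ s ] s ≤ 4 × Joined Γ s u v

  ⟶-refl : ∀ {u v} → u ≈ᵛ v → u ⟶ v
  ⟶-refl {u} e = 0 , z≤n , const u , ((λ _ ()) , (λ _ ())) , ≈ᵛ-refl , e

  ⟶₁ : ∀ {u v} → u ~ v → u ⟶ v
  ⟶₁ {u} {v} s = 1 , s≤s z≤n , cons u (const v) , path-edge Γ s , ≈ᵛ-refl , ≈ᵛ-refl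

  ⟶₂ : ∀ {u v w} → u ~ v → v ~ w → ¬ (u ≈ᵛ w) → u ⟶ w
  ⟶₂ {u} {v} {w} s s′ t = 2 , s≤s (s≤s z≤n) , cons u (cons v (const w)) ,
    path-cons Γ s t (path-edge Γ s′) , ≈ᵛ-refl , ≈ᵛ-refl

  ⟶₃ : ∀ {u v w x} → u ~ v → v ~ w → w ~ x → ¬ (u ≈ᵛ w) → ¬ (v ≈ᵛ x) → u ⟶ x
  ⟶₃ {u} {v} {w} {x} s s′ s″ t t′ = 3 , s≤s (s≤s (s≤s z≤n)) ,
    cons u (cons v (cons w (const x))) ,
    path-cons Γ s t (path-cons Γ s′ t′ (path-edge Γ s″)) , ≈ᵛ-refl , ≈ᵛ-refl

  ⟶₄ : ∀ {u v w x y} → u ~ v → v ~ w → w ~ x → x ~ y →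
        ¬ (u ≈ᵛ w) → ¬ (v ≈ᵛ x) → ¬ (w ≈ᵛ y) → u ⟶ y
  ⟶₄ {u} {v} {w} {x} {y} s s′ s″ s‴ t t′ t″ = 4 , ≤-refl ,
    cons u (cons v (cons w (cons x (const y)))) ,
    path-cons Γ s t (path-cons Γ s′ t′ (path-cons Γ s″ t″ (path-edge Γ s‴))) , ≈ᵛ-refl , ≈ᵛ-refl

  -- Both alternatives of `reach` give a point of `x` collinear with `a`: the foot, or any point of
  -- `x`.
  connect : ∀ {a x} → ¬ (a ∈ x) →
            ∃[ z ] ∃[ b ] a ∈ z × b ∈ z × b ∈ x × ¬ (a ≈ b) × ¬ (z ≈ˡ x)
  connect {a} {x} a∉x with reach a (inj₂ x)
  ... | inj₁ π = side π , foot π , a∈side π , foot∈side π , foot∈x π , a≉foot π ,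
                 λ e → a∉x (∈-respˡ e (a∈side π))
  ... | inj₂ all with pointOn x
  ... | b , b∈x with ⟂-joined S (λ a≈b → a∉x (∈-resp (≈-sym a≈b) b∈x)) (all b∈x)
  ... | z , a∈z , b∈z = z , b , a∈z , b∈z , b∈x , (λ a≈b → a∉x (∈-resp (≈-sym a≈b) b∈x)) ,
                        λ e → a∉x (∈-respˡ e a∈z)

  distance≤4 : ∀ u v → u ⟶ v
  distance≤4 (inj₁ a) (inj₁ b) with em {a ≈ b} | reach a (inj₁ b)
  ... | yes a≈b | _          = ⟶-refl (inj₁ a≈b)
  ... | no  _   | inj₂ o     = 4 , ≤-refl , ⟂̸-path o , proj₁ (⟂̸-straight o) , ≈ᵛ-refl , ≈ᵛ-refl
  ... | no  a≉b | inj₁ a⟂b with ⟂-joined S a≉b a⟂b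
  ... | x , a∈x , b∈x        = ⟶₂ (~-sym a∈x) b∈x (a≉b ∘ drop-inj₁)
  distance≤4 (inj₁ a) (inj₂ x) with em {a ∈ x}
  ... | yes a∈x = ⟶₁ (~-sym a∈x)
  ... | no  a∉x with connect a∉x
  ... | z , b , a∈z , b∈z , b∈x , a≉b , z≉x =
    ⟶₃ (~-sym a∈z) b∈z (~-sym b∈x) (a≉b ∘ drop-inj₁) (z≉x ∘ drop-inj₂)
  distance≤4 (inj₂ x) (inj₁ a) with em {a ∈ x}
  ... | yes a∈x = ⟶₁ a∈x
  ... | no  a∉x with connect a∉x
  ... | z , b , a∈z , b∈z , b∈x , a≉b , z≉x =
    ⟶₃ b∈x (~-sym b∈z) a∈z (z≉x ∘ ≈ˡ-sym ∘ drop-inj₂) (a≉b ∘ ≈-sym ∘ drop-inj₁)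
  distance≤4 (inj₂ x) (inj₂ y) with em {x ≈ˡ y} | pointOn x
  ... | yes x≈y | _ = ⟶-refl (inj₂ x≈y)
  ... | no  x≉y | a , a∈x with em {a ∈ y}
  ... | yes a∈y = ⟶₂ a∈x (~-sym a∈y) (x≉y ∘ drop-inj₂)
  ... | no  a∉y with connect a∉y
  ... | z , b , a∈z , b∈z , b∈y , a≉b , z≉y with em {x ≈ˡ z}
  ... | yes x≈z = ⟶₂ (∈-respˡ (≈ˡ-sym x≈z) b∈z) (~-sym b∈y) (x≉y ∘ drop-inj₂)
  ... | no  x≉z = ⟶₄ a∈x (~-sym a∈z) b∈z (~-sym b∈y)
                    (x≉z ∘ drop-inj₂) (a≉b ∘ drop-inj₁) (z≉y ∘ drop-inj₂)

  -- Lengths 1 and 3 fail by parity; length 0 or 2 would make `a` and `c` collinear.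
  distance≥4 : ∀ {a c} → a ⟂̸ c → ∀ s → Joined Γ s (inj₁ a) (inj₁ c) → 4 ≤ s
  distance≥4 o 0 (_ , _ , e₀ , e₁) =
    contradiction (inj₁ (drop-inj₁ (≈ᵛ-trans (≈ᵛ-sym e₀) e₁))) (⟂̸⇒¬⟂ o)
  distance≥4 o 1 (p , (edge , _) , e₀ , e₁)
    with () ← ≡-trans (≡-trans (≡-sym (isPoint-resp e₁)) (isPoint-walk p 1 edge))
                      (cong not (isPoint-resp e₀))
  distance≥4 {a} {c} o 2 (p , (edge , _) , e₀ , e₂) =
    ⊥-elim (collinear (p 0) (p 1) (p 2) e₀ e₂ (edge 0 (s≤s z≤n)) (edge 1 ≤-refl))
    where
    collinear : ∀ v₀ v₁ v₂ → v₀ ≈ᵛ inj₁ a → v₂ ≈ᵛ inj₁ c → v₀ ~ v₁ → v₁ ~ v₂ → ⊥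
    collinear (inj₁ b) (inj₁ d) _ _ _ s _ = proj₁ bipartition b d s
    collinear (inj₁ _) (inj₂ x) (inj₁ _) (inj₁ e₀) (inj₁ e₂) s s′ =
      ⟂̸⇒¬⟂ o (inj₂ (x , ∈-resp e₀ (~-sym s) , ∈-resp e₂ s′))
  distance≥4 o 3 (p , (edge , _) , e₀ , e₃)
    with () ← ≡-trans (≡-trans (≡-sym (isPoint-resp e₃)) (isPoint-walk p 3 edge))
                      (cong (not ∘ not ∘ not) (isPoint-resp e₀))
  distance≥4 o (suc (suc (suc (suc s)))) _ = s≤s (s≤s (s≤s (s≤s z≤n)))

  ¬digon : ∀ {a b x y} → ¬ (a ≈ b) → ¬ (x ≈ˡ y) → a ∈ x → b ∈ x → b ∈ y → ¬ (a ∈ y)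
  ¬digon a≉b x≉y a∈x b∈x b∈y a∈y = x≉y (line-unique a≉b a∈x b∈x a∈y b∈y)

  ¬circuit₄ : ∀ (c : ℕ → Vertex) → (∀ i → c i ~ c (suc i)) →
              (∀ i → ¬ (c i ≈ᵛ c (suc (suc i)))) → ¬ (c 4 ≈ᵛ c 0)
  ¬circuit₄ c edge turn = go (c 0) (c 1) (c 2) (c 3) (c 4)
    (edge 0) (edge 1) (edge 2) (edge 3) (turn 0) (turn 1)
    where
    go : ∀ v₀ v₁ v₂ v₃ v₄ → v₀ ~ v₁ → v₁ ~ v₂ → v₂ ~ v₃ → v₃ ~ v₄ →
         ¬ (v₀ ≈ᵛ v₂) → ¬ (v₁ ≈ᵛ v₃) → ¬ (v₄ ≈ᵛ v₀)
    go (inj₁ _) (inj₂ _) (inj₁ _) (inj₂ _) (inj₁ _) s₀ s₁ s₂ s₃ t₀ t₁ (inj₁ e) =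
      ¬digon (t₀ ∘ inj₁) (t₁ ∘ inj₂) (~-sym s₀) s₁ (~-sym s₂) (∈-resp e s₃)
    go (inj₂ _) (inj₁ _) (inj₂ _) (inj₁ _) (inj₂ _) s₀ s₁ s₂ s₃ t₀ t₁ (inj₂ e) =
      ¬digon (t₁ ∘ inj₁) (t₀ ∘ inj₂) s₀ (∈-respˡ e (~-sym s₃)) s₂ (~-sym s₁)
    go (inj₁ a) (inj₁ b) _ _ _ s _ _ _ _ _ _ = proj₁ bipartition a b s
    go (inj₂ x) (inj₂ y) _ _ _ s _ _ _ _ _ _ = proj₂ bipartition x y s
    go _ (inj₁ a) (inj₁ b) _ _ _ s _ _ _ _ _ = proj₁ bipartition a b s
    go _ (inj₂ x) (inj₂ y) _ _ _ s _ _ _ _ _ = proj₂ bipartition x y s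
    go _ _ (inj₁ a) (inj₁ b) _ _ _ s _ _ _ _ = proj₁ bipartition a b s
    go _ _ (inj₂ x) (inj₂ y) _ _ _ s _ _ _ _ = proj₂ bipartition x y s

  circuit₆⇒triangle : ∀ (c : ℕ → Vertex) → (∀ i → c i ~ c (suc i)) →
                      (∀ i → ¬ (c i ≈ᵛ c (suc (suc i)))) →
                      c 6 ≈ᵛ c 0 → isPoint (c 0) ≡ true → Triangle
  circuit₆⇒triangle c edge turn = go (c 0) (c 1) (c 2) (c 3) (c 4) (c 5) (c 6)
    (edge 0) (edge 1) (edge 2) (edge 3) (edge 4) (edge 5) (turn 0) (turn 1) (turn 2)
    where
    go : ∀ v₀ v₁ v₂ v₃ v₄ v₅ v₆ →
         v₀ ~ v₁ → v₁ ~ v₂ → v₂ ~ v₃ → v₃ ~ v₄ → v₄ ~ v₅ → v₅ ~ v₆ →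
         ¬ (v₀ ≈ᵛ v₂) → ¬ (v₁ ≈ᵛ v₃) → ¬ (v₂ ≈ᵛ v₄) → v₆ ≈ᵛ v₀ → isPoint v₀ ≡ true → Triangle
    go (inj₁ _) (inj₂ _) (inj₁ _) (inj₂ y) (inj₁ _) (inj₂ z) (inj₁ _)
       s₀ s₁ s₂ s₃ s₄ s₅ t₀ t₁ t₂ (inj₁ e) _ =
      triangle (t₀ ∘ inj₁) (~-sym s₀) s₁
        (¬digon (t₂ ∘ inj₁ ∘ ≈-sym) (t₁ ∘ inj₂ ∘ ≈ˡ-sym) s₃ (~-sym s₂) s₁)
        (inj₂ (z , ~-sym s₄ , ∈-resp e s₅)) (inj₂ (y , s₃ , ~-sym s₂))
    go (inj₁ a) (inj₁ b) _ _ _ _ _ s _ _ _ _ _ = contradiction s (proj₁ bipartition a b)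
    go _ (inj₂ x) (inj₂ y) _ _ _ _ _ s _ _ _ _ = contradiction s (proj₂ bipartition x y)
    go _ _ (inj₁ a) (inj₁ b) _ _ _ _ _ s _ _ _ = contradiction s (proj₁ bipartition a b)
    go _ _ _ (inj₂ x) (inj₂ y) _ _ _ _ _ s _ _ = contradiction s (proj₂ bipartition x y)
    go _ _ _ _ (inj₁ a) (inj₁ b) _ _ _ _ _ s _ = contradiction s (proj₁ bipartition a b)

  girth≥8 : ¬ Triangle → ∀ s c → IsCircuit Γ s c → 8 ≤ s
  girth≥8 ¬triangle s c (3≤s , period , paths) = go s 3≤s period
    where
    edge : ∀ i → c i ~ c (suc i)
    edge i = proj₁ (paths 0 (suc i)) i ≤-refl
    turn : ∀ i → ¬ (c i ≈ᵛ c (suc (suc i)))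
    turn i = proj₂ (paths 0 (suc (suc i))) i ≤-refl

    parity : ∀ n → (∀ i → c (n + i) ≈ᵛ c i) → fold (isPoint (c 0)) not n ≡ isPoint (c 0)
    parity n period = ≡-trans (≡-sym (isPoint-walk c n (λ i _ → edge i)))
      (isPoint-resp (subst (λ m → c m ≈ᵛ c 0) (+-identityʳ n) (period 0)))

    notTrue : ∀ {b} → b ≢ true → not b ≡ true
    notTrue {true}  ne = contradiction refl ne
    notTrue {false} _  = refl

    go : ∀ s → 3 ≤ s → (∀ i → c (s + i) ≈ᵛ c i) → 8 ≤ s
    go 1 (s≤s ()) _
    go 2 (s≤s (s≤s ())) _
    go 3 _ period with isPoint (c 0) | parity 3 period
    ... | true  | ()
    ... | false | ()
    go 4 _ period = contradiction (period 0) (¬circuit₄ c edge turn)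
    go 5 _ period with isPoint (c 0) | parity 5 period
    ... | true  | ()
    ... | false | ()
    -- A 6-circuit that starts at a line is read from its next vertex, which is a point.
    go 6 _ period = contradiction (circuit₆⇒triangle (c ∘ suc) (edge ∘ suc) (turn ∘ suc) (period 1)
      (≡-trans (isPoint-flip _ _ (edge 0))
               (notTrue (¬triangle ∘ circuit₆⇒triangle c edge turn (period 0))))) ¬triangle
    go 7 _ period with isPoint (c 0) | parity 7 period
    ... | true  | ()
    ... | false | ()
    go (suc (suc (suc (suc (suc (suc (suc (suc s)))))))) _ _ =
      s≤s (s≤s (s≤s (s≤s (s≤s (s≤s (s≤s (s≤s z≤n)))))))

  degree≥2 : ∀ v → ∃[ x ] ∃[ y ] v ~ x × v ~ y × ¬ (x ≈ᵛ y)
  degree≥2 (inj₁ a) with lineThrough a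
  ... | x , a∈x with commonOpposite x x a∈x a∈x
  ... | y , x-y , _ = inj₂ x , inj₂ y , ~-sym a∈x , proj₂ (Opp-support x-y) ,
                      λ e → opp-antireflex _ e x-y
  degree≥2 (inj₂ x) with isThick x
  ... | a , b , _ , a∈x , b∈x , _ , a≉b , _ = inj₁ a , inj₁ b , a∈x , b∈x , a≉b ∘ drop-inj₁

  ¬triangle⇒isGeneralizedQuadrangle : ¬ Triangle → IsGeneralizedQuadrangle Γ
  ¬triangle⇒isGeneralizedQuadrangle ¬triangle = record
    { bipartite = isBipartite
    ; diameter  = distance≤4 , distant
    ; girth     = girth≥8 ¬triangle
    ; degrees   = degree≥2
    }
    where
    distant : ∃[ u ] ∃[ v ] (∀ s → Joined Γ s u v → 4 ≤ s)
    distant with pointOn someLine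
    ... | a , _ with existsOpposite a
    ... | c , a-c = inj₁ a , inj₁ c , distance≥4 a-c

  isGeneralizedQuadrangle⇒¬triangle : IsGeneralizedQuadrangle Γ → ¬ Triangle
  isGeneralizedQuadrangle⇒¬triangle gq (triangle {x} {a} {b} {c} a≉b a∈x b∈x c∉x c⟂a c⟂b)
    with ⟂-joined S (λ c≈a → c∉x (∈-resp (≈-sym c≈a) a∈x)) c⟂a
       | ⟂-joined S (λ c≈b → c∉x (∈-resp (≈-sym c≈b) b∈x)) c⟂b
  ... | z , c∈z , a∈z | y , c∈y , b∈y =
    contradiction (IsGeneralizedQuadrangle.girth gq 6 hexagon
      (s≤s (s≤s (s≤s z≤n)) , (λ _ → ≈ᵛ-refl) , walk⇒paths Γ edge turn))
      λ { (s≤s (s≤s (s≤s (s≤s (s≤s (s≤s ())))))) }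
    where
    hexagon : ℕ → Vertex
    hexagon 0 = inj₁ a
    hexagon 1 = inj₂ x
    hexagon 2 = inj₁ b
    hexagon 3 = inj₂ y
    hexagon 4 = inj₁ c
    hexagon 5 = inj₂ z
    hexagon (suc (suc (suc (suc (suc (suc i)))))) = hexagon i

    edge : ∀ i → hexagon i ~ hexagon (suc i)
    edge 0 = ~-sym a∈x
    edge 1 = b∈x
    edge 2 = ~-sym b∈y
    edge 3 = c∈y
    edge 4 = ~-sym c∈z
    edge 5 = a∈z
    edge (suc (suc (suc (suc (suc (suc i)))))) = edge i

    turn : ∀ i → ¬ (hexagon i ≈ᵛ hexagon (suc (suc i)))
    turn 0 (inj₁ a≈b) = a≉b a≈b
    turn 1 (inj₂ x≈y) = c∉x (∈-respˡ (≈ˡ-sym x≈y) c∈y)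
    turn 2 (inj₁ b≈c) = c∉x (∈-resp b≈c b∈x)
    -- If `y` and `z` agree, this line contains `a` and `b`, so it is the base and contains `c`.
    turn 3 (inj₂ y≈z) = c∉x (∈-respˡ (line-unique a≉b a∈z (∈-respˡ y≈z b∈y) a∈x b∈x) c∈z)
    turn 4 (inj₁ c≈a) = c∉x (∈-resp (≈-sym c≈a) a∈x)
    turn 5 (inj₂ z≈x) = c∉x (∈-respˡ z≈x c∈z)
    turn (suc (suc (suc (suc (suc (suc i)))))) = turn i

  rank2⇔isGeneralizedQuadrangle : HasRank S [ 2 ] ⇔ IsGeneralizedQuadrangle Γ
  rank2⇔isGeneralizedQuadrangle = mk⇔
    (¬triangle⇒isGeneralizedQuadrangle ∘ rank2⇒¬triangle unique)
    (¬triangle⇒rank2 unique someLine ∘ isGeneralizedQuadrangle⇒¬triangle)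
    where
    unique : ∀ {a b x y} → ¬ (a ≈ b) → a ∈ x → b ∈ x → a ∈ y → b ∈ y → ∀ {c} → c ∈ x → c ∈ y
    unique a≉b a∈x b∈x a∈y b∈y = ∈-respˡ (line-unique a≉b a∈x b∈x a∈y b∈y)

mainTheorem17 : ∀ {ℓ} → ExcludedMiddle (lsuc ℓ) →
    (∀ {P L : Setoid ℓ ℓ} (Γ : OppGraph (P ⊎ₛ L)) →
    IsFlatGreenVeldkampQuadrangle Γ →
    (IsPolarSpace (lineSpace Γ) × IsThick (lineSpace Γ) ×
    IsNonDegenerate (lineSpace Γ) × PointLineStructure.Line (lineSpace Γ)) ×
    IsIsomorphism Γ (incidenceGraph (lineSpace Γ)) (canonicalMap Γ) ×
    (HasRank (lineSpace Γ) [ 2 ] ⇔ IsGeneralizedQuadrangle Γ)) ×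
    (∀ {P : Setoid ℓ ℓ} (S : PointLineStructure P) →
    IsPolarSpace S → IsThick S → IsNonDegenerate S → PointLineStructure.Line S →
    lineSpace (incidenceGraph S) ≋ S)
mainTheorem17 {ℓ} em =
  (λ Γ isQuadrangle → let open Quadrangle em′ Γ isQuadrangle in
    (isPolarSpace , isThick , isNonDegenerate , someLine) ,
    isIsomorphism , rank2⇔isGeneralizedQuadrangle) ,
  -- In `incidenceGraph S` the neighbours of a line `x` are the members of `points x` by definition,
  -- so both structures have definitionally the same lines.
  (λ _ _ _ _ _ _ → mk⇔ id id)
  where
  em′ : ExcludedMiddle ℓ
  em′ = map′ lower lift em
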